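{- Let $n\ge 3$ be an integer, let $l=\lfloor n/2\rfloor$ and $h=\lceil n/2\rceil$, and let $K=\{123,321\}\{132,231\}$. The number of equivalence classes of $S_n$ under $K$-equivalence is $$\sum_{j=1}^{l} j!\cdot\binom{n-j-1}{h-1}+\sum_{j=1}^{h} j!\cdot\binom{n-j-1}{l-1}.$$
   Context: Permutations in $S_n$ are written as words $\pi_1\pi_2\cdots\pi_n$ in one-line notation. The order permutation of a word $u$ of $c$ distinct positive integers is the unique $\sigma\in S_c$ with $\sigma_i<\sigma_j$ iff $u_i<u_j$. A replacement partition $K$ of $S_c$ is a set partition of $S_c$; it is denoted by listing its parts with the one-element parts (and outer brackets) omitted, so here $K$ is the set partition of $S_3$ whose only parts of size greater than one are $\{123,321\}$ and $\{132,231\}$. The $K$-equivalence on $S_n$ is the equivalence relation generated by: $\phi\equiv\psi$ whenever $\phi=aub$ and $\psi=avb$ (concatenations) for some possibly empty words $a,b$ and words $u,v$ of length $c$ (so $u,v$ occupy the same $c$ consecutive positions) such that the order permutations of $u$ and $v$ lie in the same part of $K$. All equivalence classes are counted, including one-element classes. -}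

module Defs where

open import Data.List.Base using (List; []; _∷_; _++_; sum; applyUpTo)
open import Data.List.Membership.Propositional using (_∈_)
open import Data.List.Relation.Binary.Disjoint.Propositional using (Disjoint)
open import Data.List.Relation.Binary.Permutation.Propositional
  using (_↭_; ↭-refl; prep; swap)
open import Data.List.Relation.Binary.Permutation.Propositional.Properties
  using (↭-reverse; ++-comm)
open import Data.List.Relation.Unary.All using ([]; _∷_)
open import Data.List.Relation.Unary.AllPairs using (AllPairs; []; _∷_)
open import Data.List.Relation.Unary.Any using (Any; here; there)
open import Data.Nat.Base using (ℕ; suc; _<_)
open import Data.Product.Base using (_×_; _,_)
open import Data.Sum.Base using (_⊎_)
open import Data.Vec.Base using (Vec; []; _∷_; lookup; toList)
open import Function.Bundles using (_⇔_)
open import Level using (0ℓ)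
open import Relation.Binary.Bundles using (Setoid)
open import Relation.Binary.Core using (Rel)
open import Relation.Binary.PropositionalEquality.Core using (_≡_; refl)
import Relation.Binary.Construct.Closure.Equivalence as EqClosure

-- An element of Sₙ in one-line notation, with letters 1, …, n.  The proof
-- field is irrelevant, so that permutations with the same word are equal.
record Perm (n : ℕ) : Set where
  constructor perm
  field
    word           : Vec ℕ n
    .rearrangement : toList word ↭ applyUpTo suc n

open Perm public

IsOrderPermutation : ∀ {c} → Perm c → Vec ℕ c → Set
IsOrderPermutation σ u =
  ∀ i j → (lookup (word σ) i < lookup (word σ) j) ⇔ (lookup u i < lookup u j)

-- A set partition of S_c, given by a list of parts that includes every part
-- with more than one element; each permutation that is not listed forms a
-- part by itself.
record ReplacementPartition (c : ℕ) : Set where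
  field
    parts    : List (List (Perm c))
    disjoint : AllPairs Disjoint parts

  SamePart : Rel (Perm c) 0ℓ
  SamePart σ τ = σ ≡ τ ⊎ Any (λ P → σ ∈ P × τ ∈ P) parts

open ReplacementPartition public using (SamePart)

-- The words u and v of φ and ψ need no separate distinctness hypothesis,
-- since they are factors of words with distinct letters.
data Replacement {c} (K : ReplacementPartition c) {n} (φ ψ : Perm n) : Set where
  replace : (a b : List ℕ) (u v : Vec ℕ c) (σ τ : Perm c) →
            toList (word φ) ≡ a ++ toList u ++ b →
            toList (word ψ) ≡ a ++ toList v ++ b →
            IsOrderPermutation σ u →
            IsOrderPermutation τ v →
            SamePart K σ τ →
            Replacement K φ ψ

S[_]/_ : ∀ (n : ℕ) {c} → ReplacementPartition c → Setoid 0ℓ 0ℓ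
S[ n ]/ K = EqClosure.setoid (Replacement K {n})

p123 p321 p132 p231 : Perm 3
p123 = perm (1 ∷ 2 ∷ 3 ∷ []) ↭-refl
p321 = perm (3 ∷ 2 ∷ 1 ∷ []) (↭-reverse (1 ∷ 2 ∷ 3 ∷ []))
p132 = perm (1 ∷ 3 ∷ 2 ∷ []) (prep 1 (swap 3 2 ↭-refl))
p231 = perm (2 ∷ 3 ∷ 1 ∷ []) (++-comm (2 ∷ 3 ∷ []) (1 ∷ []))

K₀ : ReplacementPartition 3
K₀ = record
  { parts    = (p123 ∷ p321 ∷ []) ∷ (p132 ∷ p231 ∷ []) ∷ []
  ; disjoint = (disj ∷ []) ∷ [] ∷ []
  }
  where
  disj : Disjoint (p123 ∷ p321 ∷ []) (p132 ∷ p231 ∷ [])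
  disj (here refl         , here ())
  disj (here refl         , there (here ()))
  disj (there (here refl) , here ())
  disj (there (here refl) , there (here ()))

∑[1⋯_] : ℕ → (ℕ → ℕ) → ℕ
∑[1⋯ m ] f = sum (applyUpTo (λ i → f (suc i)) m)

{-# OPTIONS --safe #-}
module Submission where

-- Call a letter odd or even according to the parity of its place.  The four
-- patterns 123, 321, 132, 231 are those whose middle letter is not the least, so
-- a replacement exchanges the outer letters of a factor x y z with y > x or
-- y > z.  It preserves the set of odd and the set of even letters.  Call a letter
-- top if it exceeds all letters of the other parity.  Since x and z are never
-- both top, the order in which the top letters occur is preserved as well.
--
-- Conversely these invariants determine the class (lemma connected), by
-- induction on the length.  The least letter m passes every letter of its own
-- parity.  If m can thus reach an end of the word, it is removed.  Otherwise the
-- length is odd and m is even; then m moves to the second place or to the last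
-- place but one, and the induction hypothesis rearranges the letters other than
-- m and the first, or m and the last, letter.  The exchanges of neighbouring odd
-- letters that are not both top leave the first or the last letter alone, and
-- they generate all rearrangements of the odd letters that keep the order of the
-- top ones (swaps-complete, rearrange-odds).  The even letters are rearranged
-- while an odd letter that is not the greatest one is kept at its end of the
-- word, since this does not affect which even letters are top (rearrange-evens).
--
-- Only the parity of the greatest letter n has top letters, and these are the j
-- greatest letters n, …, n - j + 1, where n - j is the greatest letter of the
-- other parity.  There are j ! orders of them, and the remaining letters of the
-- other parity are chosen from the n - j - 1 letters below (count-half).  The two
-- sums belong to the greatest letter being even and being odd.

open import Defs
open import Data.Bool.Base using (Bool; true; false; not; if_then_else_)
open import Data.Bool.Properties using (not-¬; ¬-not) renaming (_≟_ to _≟ᵇ_)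
open import Data.Empty using (⊥; ⊥-elim)
open import Data.Fin.Base using (Fin; zero; suc)
open import Data.Fin.Patterns using (0F; 1F; 2F)
open import Data.List.Base as List
  using (List; []; _∷_; _++_; [_]; _∷ʳ_; length; filter; initLast; _∷ʳ′_;
         applyUpTo; upTo; map; replicate)
open import Data.List.Membership.Propositional using (_∈_)
open import Data.List.Membership.Propositional.Properties
  using (∈-∃++; ∈-++⁺ˡ; ∈-++⁺ʳ; ∈-++⁻; ∈-map⁺; ∈-map⁻; ∈-lookup; ∈-upTo⁺; ∈-upTo⁻)
open import Data.List.Membership.Propositional.Properties.WithK using (unique∧set⇒bag)
open import Data.List.Properties
  using (≡-dec; ∷-injectiveˡ; ∷-injectiveʳ; ++-identityʳ; length-++; length-++-≤ˡ;
         length-map; length-applyUpTo; applyUpTo-∷ʳ; map-upTo;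
         filter-++; filter-accept; filter-reject; filter-all; filter-none)
open import Data.List.Relation.Binary.BagAndSetEquality using (∼bag⇒↭)
open import Data.List.Relation.Binary.Disjoint.Propositional using (Disjoint)
open import Data.List.Relation.Binary.Equality.Propositional using (≋⇒≡)
open import Data.List.Relation.Binary.Permutation.Propositional
  using (_↭_; ↭-refl; ↭-sym; ↭-trans; ↭-reflexive; prep; swap; ↭⇒↭ₛ)
open import Data.List.Relation.Binary.Permutation.Propositional.Properties
  using (All-resp-↭; ∈-resp-↭; ↭-length; ↭-empty-inv; ↭-singleton-inv; ↭-reverse; drop-∷; drop-mid;
         shift; ++⁺; ++⁺ʳ; ++-comm; ∷↭∷ʳ; filter-↭)
import Data.List.Relation.Binary.Permutation.Setoid.Properties as Setoid-↭
open import Data.List.Relation.Unary.All as All using (All; []; _∷_; all?)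
import Data.List.Relation.Unary.All.Properties as All
open import Data.List.Relation.Unary.AllPairs using ([]; _∷_)
open import Data.List.Relation.Unary.Any as Any using (here; there; index)
open import Data.List.Relation.Unary.Any.Properties using (lookup-index)
open import Data.List.Relation.Unary.Linked using ([-]; _∷_)
open import Data.List.Relation.Unary.Sorted.TotalOrder.Properties using (↗↭↗⇒≋)
open import Data.List.Relation.Unary.Unique.Propositional using (Unique)
import Data.List.Relation.Unary.Unique.Propositional.Properties as Unique
open import Data.Nat.Base
  using (ℕ; zero; suc; _+_; _*_; _∸_; _≤_; _<_; z≤n; s≤s; ⌊_/2⌋; ⌈_/2⌉; _!)
open import Data.Nat.Combinatorics using (_C_; nCk+nC[k+1]≡[n+1]C[k+1])
open import Data.Nat.Induction using (<-rec)
open import Data.Nat.ListAction using (sum)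
open import Data.Nat.Properties
open import Data.List.Membership.DecPropositional _≟_ using (_∈?_)
open import Data.List.Relation.Unary.Sorted.TotalOrder ≤-totalOrder using (Sorted)
open import Data.List.Sort ≤-decTotalOrder using (sort; sort-↭; sort-↗)
open import Data.Product.Base as Product using (_×_; _,_; ∃; proj₁; proj₂)
open import Data.Sum.Base as Sum using (_⊎_; inj₁; inj₂)
open import Data.Vec.Base as Vec using (Vec; []; _∷_; lookup; toList; fromList)
import Data.Vec.Properties as Vec
open import Function.Base using (_∘_; id; const)
open import Function.Bundles using (Bijection; _⇔_; mk⇔; Equivalence)
open import Level using (0ℓ)
open import Relation.Binary.Bundles using (Setoid)
open import Relation.Binary.Construct.Closure.Equivalence as Eq using (EqClosure)
open import Relation.Binary.Construct.Closure.ReflexiveTransitive using (Star; ε; _◅_; _◅◅_; gmap)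
open import Relation.Binary.Construct.Closure.Symmetric using (fwd; bwd)
open import Relation.Binary.Core using (Rel)
open import Relation.Binary.Definitions using (tri<; tri≈; tri>)
open import Relation.Binary.PropositionalEquality
  using (_≡_; _≢_; refl; sym; trans; cong; cong₂; subst; subst₂; setoid; module ≡-Reasoning)
open import Relation.Binary.Structures using (IsEquivalence)
open import Relation.Nullary using (¬_; yes; no; does; contradiction; recompute)
open import Relation.Nullary.Decidable using (dec-true; dec-false; does-⇔; ¬?)
open import Relation.Unary using (Pred; Decidable)

-- Odd and even places of a word

-- The letters of a word at its odd and at its even places, counted from 1.
-- Below, an odd or even letter is a letter at an odd or even place.
odds evens : List ℕ → List ℕ
odds []        = []
odds (x ∷ xs)  = x ∷ evens xs
evens []       = []
evens (x ∷ xs) = odds xs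

-- The word with odd letters as and even letters bs.  If the lists
-- are not Balanced, the surplus of the longer one comes last.
weave : List ℕ → List ℕ → List ℕ
weave []       bs = bs
weave (a ∷ as) bs = a ∷ weave bs as

-- The lengths that the odd and the even letters of a word can have.
Balanced : Rel (List ℕ) 0ℓ
Balanced as bs = length as ≡ length bs ⊎ length as ≡ suc (length bs)

balanced-tail : ∀ a as bs → Balanced (a ∷ as) bs → Balanced bs as
balanced-tail a as bs (inj₁ eq) = inj₂ (sym eq)
balanced-tail a as bs (inj₂ eq) = inj₁ (sym (suc-injective eq))

odds-evens-balanced : ∀ w → Balanced (odds w) (evens w)
odds-evens-balanced []      = inj₁ refl
odds-evens-balanced (x ∷ w) = Sum.swap (Sum.map (cong suc ∘ sym) sym (odds-evens-balanced w))

weave-odds-evens : ∀ w → weave (odds w) (evens w) ≡ w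
weave-odds-evens []      = refl
weave-odds-evens (x ∷ w) = cong (x ∷_) (weave-odds-evens w)

odds-weave  : ∀ as bs → Balanced as bs → odds (weave as bs) ≡ as
evens-weave : ∀ as bs → Balanced as bs → evens (weave as bs) ≡ bs
odds-weave []       []       _   = refl
odds-weave []       (b ∷ bs) (inj₁ ())
odds-weave []       (b ∷ bs) (inj₂ ())
odds-weave (a ∷ as) bs       bal = cong (a ∷_) (evens-weave bs as (balanced-tail a as bs bal))
evens-weave []       []       _   = refl
evens-weave []       (b ∷ bs) (inj₁ ())
evens-weave []       (b ∷ bs) (inj₂ ())
evens-weave (a ∷ as) bs       bal = odds-weave bs as (balanced-tail a as bs bal)

weave-∷ʳ-odd  : ∀ as bs {x} → length as ≡ length bs →
                weave (as ∷ʳ x) bs ≡ weave as bs ∷ʳ x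
weave-∷ʳ-even : ∀ as bs {x} → length as ≡ suc (length bs) →
                weave as (bs ∷ʳ x) ≡ weave as bs ∷ʳ x
weave-∷ʳ-odd []       []  eq = refl
weave-∷ʳ-odd (a ∷ as) bs  eq = cong (a ∷_) (weave-∷ʳ-even bs as (sym eq))
weave-∷ʳ-even (a ∷ as) bs eq = cong (a ∷_) (weave-∷ʳ-odd bs as (sym (suc-injective eq)))

odds++evens-↭ : ∀ w → odds w ++ evens w ↭ w
odds++evens-↭ []      = ↭-refl
odds++evens-↭ (x ∷ w) = prep x (↭-trans (++-comm (evens w) (odds w)) (odds++evens-↭ w))

-- Filtering lists

module _ {A : Set} {P : Pred A 0ℓ} (P? : Decidable P) where

  filter-remove : ∀ p {x s} → ¬ P x → filter P? (p ++ x ∷ s) ≡ filter P? (p ++ s)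
  filter-remove p {x} {s} ¬px = begin
    filter P? (p ++ x ∷ s)            ≡⟨ filter-++ P? p (x ∷ s) ⟩
    filter P? p ++ filter P? (x ∷ s)  ≡⟨ cong (filter P? p ++_) (filter-reject P? ¬px) ⟩
    filter P? p ++ filter P? s        ≡⟨ filter-++ P? p s ⟨
    filter P? (p ++ s)                ∎
    where open ≡-Reasoning

  filter-cong-local : ∀ {Q : Pred A 0ℓ} (Q? : Decidable Q) xs →
                      (∀ {x} → x ∈ xs → P x → Q x) → (∀ {x} → x ∈ xs → Q x → P x) →
                      filter P? xs ≡ filter Q? xs
  filter-cong-local Q? []       to from = refl
  filter-cong-local Q? (x ∷ xs) to from with P? x
  ... | yes px = trans (cong (x ∷_) (filter-cong-local Q? xs (to ∘ there) (from ∘ there)))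
                       (sym (filter-accept Q? (to (here refl) px)))
  ... | no ¬px = trans (filter-cong-local Q? xs (to ∘ there) (from ∘ there))
                       (sym (filter-reject Q? (¬px ∘ from (here refl))))

  filter-∷-injective : ∀ x {xs ys} → filter P? (x ∷ xs) ≡ filter P? (x ∷ ys) →
                       filter P? xs ≡ filter P? ys
  filter-∷-injective x eq with P? x
  ... | yes _ = ∷-injectiveʳ eq
  ... | no  _ = eq

-- Exchanging neighbours that do not both satisfy a predicate

-- Exchange of two neighbours, of which at least one lies outside P.
data Swap {A : Set} (P : Pred A 0ℓ) : Rel (List A) 0ℓ where
  here  : ∀ {x y s} → ¬ (P x × P y) → Swap P (x ∷ y ∷ s) (y ∷ x ∷ s)
  there : ∀ {x s t} → Swap P s t → Swap P (x ∷ s) (x ∷ t)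

swap-↭ : ∀ {A : Set} {P : Pred A 0ℓ} {s t} → Swap P s t → s ↭ t
swap-↭ (here _)  = swap _ _ ↭-refl
swap-↭ (there r) = prep _ (swap-↭ r)

module _ {A : Set} {P : Pred A 0ℓ} (P? : Decidable P) where

  swap-filter : ∀ {s t} → Swap P s t → filter P? s ≡ filter P? t
  swap-filter (here {x} {y} {s} ¬both) with P? x | P? y
  ... | yes px | yes py = contradiction (px , py) ¬both
  ... | yes px | no ¬py = trans (cong (x ∷_) (filter-reject P? ¬py)) (sym (filter-accept P? px))
  ... | no ¬px | yes py = trans (filter-accept P? py) (cong (y ∷_) (sym (filter-reject P? ¬px)))
  ... | no ¬px | no ¬py = trans (filter-reject P? ¬py) (sym (filter-reject P? ¬px))
  swap-filter (there {x} r) with P? x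
  ... | yes _ = cong (x ∷_) (swap-filter r)
  ... | no  _ = swap-filter r

  -- The letter y moves to the front if it lies outside P, or if it is the first
  -- letter of xs in P, so that all letters that it passes lie outside P.
  bring-to-front : ∀ {y xs} → y ∈ xs → ¬ P y ⊎ ∃ (λ t → filter P? xs ≡ y ∷ t) →
                   ∃ λ zs → Star (Swap P) xs (y ∷ zs)
  bring-to-front (here refl) _ = _ , ε
  bring-to-front (there y∈) (inj₁ ¬py) =
    let zs , r = bring-to-front y∈ (inj₁ ¬py)
    in _ , gmap _ there r ◅◅ here (¬py ∘ proj₂) ◅ ε
  bring-to-front {xs = x ∷ xs} (there y∈) (inj₂ (t , eq)) with P? x
  ... | yes px rewrite ∷-injectiveˡ eq = _ , ε
  ... | no ¬px =
    let zs , r = bring-to-front y∈ (inj₂ (t , eq))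
    in _ , gmap _ there r ◅◅ here (¬px ∘ proj₁) ◅ ε

  swaps-↭ : ∀ {s t} → Star (Swap P) s t → s ↭ t
  swaps-↭ ε        = ↭-refl
  swaps-↭ (r ◅ rs) = ↭-trans (swap-↭ r) (swaps-↭ rs)

  swaps-filter : ∀ {s t} → Star (Swap P) s t → filter P? s ≡ filter P? t
  swaps-filter ε        = refl
  swaps-filter (r ◅ rs) = trans (swap-filter r) (swaps-filter rs)

  accepted-first : ∀ y xs {ys} → filter P? xs ≡ filter P? (y ∷ ys) →
                   ¬ P y ⊎ ∃ (λ t → filter P? xs ≡ y ∷ t)
  accepted-first y xs eq with P? y
  ... | yes py = inj₂ (_ , eq)
  ... | no ¬py = inj₁ ¬py

  -- The order of the letters in P is the only obstruction to a rearrangement by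
  -- such exchanges.
  swaps-complete : ∀ {xs} ys → xs ↭ ys → filter P? xs ≡ filter P? ys → Star (Swap P) xs ys
  swaps-complete []       p eq rewrite ↭-empty-inv p = ε
  swaps-complete {xs} (y ∷ ys) p eq
    with zs , r ← bring-to-front (∈-resp-↭ (↭-sym p) (here refl)) (accepted-first y xs eq)
    = r ◅◅ gmap (y ∷_) there
             (swaps-complete ys (drop-∷ (↭-trans (↭-sym (swaps-↭ r)) p))
               (filter-∷-injective P? y (trans (sym (swaps-filter r)) eq)))

-- Replacements on words

-- A replacement on words with distinct letters: the patterns 123, 321, 132 and
-- 231 are those in which the middle letter is not the least of the three.
data Step : Rel (List ℕ) 0ℓ where
  here  : ∀ {x y z w} → x < y ⊎ z < y → Step (x ∷ y ∷ z ∷ w) (z ∷ y ∷ x ∷ w)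
  there : ∀ {x v w} → Step v w → Step (x ∷ v) (x ∷ w)

infix 4 _~_
_~_ : Rel (List ℕ) 0ℓ
_~_ = EqClosure Step

~-refl : ∀ {v} → v ~ v
~-refl = Eq.reflexive Step

~-sym : ∀ {v w} → v ~ w → w ~ v
~-sym = Eq.symmetric Step

~-trans : ∀ {u v w} → u ~ v → v ~ w → u ~ w
~-trans = Eq.transitive Step

~-reflexive : ∀ {v w} → v ≡ w → v ~ w
~-reflexive refl = ~-refl

~-∷ : ∀ x {v w} → v ~ w → x ∷ v ~ x ∷ w
~-∷ x = Eq.gmap (x ∷_) there

step-++ʳ : ∀ b {v w} → Step v w → Step (v ++ b) (w ++ b)
step-++ʳ b (here lt) = here lt
step-++ʳ b (there r) = there (step-++ʳ b r)

~-++ʳ : ∀ b {v w} → v ~ w → v ++ b ~ w ++ b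
~-++ʳ b = Eq.gmap (_++ b) (step-++ʳ b)

-- A letter smaller than all letters of the other parity passes every letter of
-- its own parity.  The length condition provides a letter between m and each
-- letter that it passes.
weave-to-front : ∀ p {m s bs} → All (m <_) bs → length p ≤ length bs →
                 weave (p ++ m ∷ s) bs ~ weave (m ∷ p ++ s) bs
weave-to-front []      m<bs       _         = ~-refl
weave-to-front (q ∷ p) {m} {s} {b ∷ bs} (m<b ∷ m<bs) (s≤s le) =
  ~-trans (~-∷ q (~-∷ b (weave-to-front p m<bs le)))
          (Eq.return (here (inj₂ m<b)))

weave-to-front-even : ∀ p {m s as} → All (m <_) as → length p < length as →
                      weave as (p ++ m ∷ s) ~ weave as (m ∷ p ++ s)
weave-to-front-even p {as = a ∷ as} (_ ∷ m<as) (s≤s le) = ~-∷ a (weave-to-front p m<as le)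

-- Top letters

-- The letters that exceed all of bs.
Above : List ℕ → Pred ℕ 0ℓ
Above bs a = All (_< a) bs

above? : ∀ bs → Decidable (Above bs)
above? bs a = all? (_<? a) bs

-- The top letters of as, in their order in as: those that exceed all letters of
-- the other parity.
top : List ℕ → List ℕ → List ℕ
top as bs = filter (above? bs) as

-- Agreement of the invariants of two words, given by their odd and even letters.
record Similar (as bs as′ bs′ : List ℕ) : Set where
  field
    odd-↭    : as ↭ as′
    even-↭   : bs ↭ bs′
    odd-top  : top as bs ≡ top as′ bs′
    even-top : top bs as ≡ top bs′ as′

open Similar

similar-flip : ∀ {as bs as′ bs′} → Similar as bs as′ bs′ → Similar bs as bs′ as′
similar-flip s = record
  { odd-↭ = even-↭ s ; even-↭ = odd-↭ s ; odd-top = even-top s ; even-top = odd-top s }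

top-congʳ : ∀ as {bs bs′} → bs ↭ bs′ → top as bs ≡ top as bs′
top-congʳ as {bs} {bs′} p = filter-cong-local (above? bs) (above? bs′) as
  (λ _ → All-resp-↭ p) (λ _ → All-resp-↭ (↭-sym p))

-- An exchange of two odd letters that are not both top changes no invariant.
swap-similar : ∀ {as as′ bs} → Swap (Above bs) as as′ → Similar as bs as′ bs
swap-similar {bs = bs} r = record
  { odd-↭ = swap-↭ r ; even-↭ = ↭-refl
  ; odd-top = swap-filter (above? bs) r ; even-top = top-congʳ bs (swap-↭ r) }

-- A letter below all letters of the other parity, if there are any, is not top,
-- and it never prevents a letter of the other parity from being top.  Hence
-- similarity survives its removal.
remove-least : ∀ {m b} p s p′ s′ {bs bs′} → b ∈ bs → All (m <_) bs →
               Similar (p ++ m ∷ s) bs (p′ ++ m ∷ s′) bs′ → Similar (p ++ s) bs (p′ ++ s′) bs′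
remove-least {m} p s p′ s′ {bs} {bs′} b∈bs m<bs sim = record
  { odd-↭    = drop-mid p p′ (odd-↭ sim)
  ; even-↭   = even-↭ sim
  ; odd-top  = trans (sym (filter-remove (above? bs) p (not-above b∈bs m<bs)))
                 (trans (odd-top sim)
                   (filter-remove (above? bs′) p′ (not-above (∈-resp-↭ (even-↭ sim) b∈bs) m<bs′)))
  ; even-top = trans (sym (forget p s m<bs)) (trans (even-top sim) (forget p′ s′ m<bs′))
  }
  where
  m<bs′ : All (m <_) bs′
  m<bs′ = All-resp-↭ (even-↭ sim) m<bs

  not-above : ∀ {b cs} → b ∈ cs → All (m <_) cs → ¬ Above cs m
  not-above b∈ m<cs above = <-asym (All.lookup m<cs b∈) (All.lookup above b∈)

  forget : ∀ p s {cs} → All (m <_) cs → top cs (p ++ m ∷ s) ≡ top cs (p ++ s)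
  forget p s {cs} m<cs = filter-cong-local (above? (p ++ m ∷ s)) (above? (p ++ s)) cs
    (λ _ above → All.++⁺ (All.++⁻ˡ p above) (All.tail (All.++⁻ʳ p above)))
    (λ c∈ above → All.++⁺ (All.++⁻ˡ p above) (All.lookup m<cs c∈ ∷ All.++⁻ʳ p above))

least : ∀ x xs → ∃ λ m → m ∈ x ∷ xs × All (m ≤_) (x ∷ xs)
least x []       = x , here refl , ≤-refl ∷ []
least x (y ∷ xs) with least y xs
... | m , m∈ , m≤ with ≤-total x m
...   | inj₁ x≤m = x , here refl , ≤-refl ∷ All.map (≤-trans x≤m) m≤
...   | inj₂ m≤x = m , there m∈ , m≤x ∷ m≤

greatest : ∀ x xs → ∃ λ m → m ∈ x ∷ xs × All (_≤ m) (x ∷ xs)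
greatest x []       = x , here refl , ≤-refl ∷ []
greatest x (y ∷ xs) with greatest y xs
... | m , m∈ , ≤m with ≤-total x m
...   | inj₁ x≤m = m , there m∈ , x≤m ∷ ≤m
...   | inj₂ m≤x = x , here refl , ≤-refl ∷ All.map (λ le → ≤-trans le m≤x) ≤m

-- Words whose least letter is stuck at the even places

-- Similar words of length N with distinct letters are equivalent; distinctness
-- is needed only between letters of different parity.
Connected : ℕ → Set
Connected N = ∀ {as bs as′ bs′} → length as + length bs ≡ N → Balanced as bs →
              Disjoint as bs → Similar as bs as′ bs′ → weave as bs ~ weave as′ bs′

length-∷ʳ : ∀ {A : Set} (s : List A) z → length (s ∷ʳ z) ≡ suc (length s)
length-∷ʳ s z = trans (length-++ s) (+-comm (length s) 1)

-- Only the greatest odd letter matters for which even letters are top.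
top-restrict : ∀ {t as as₁} cs → t ∈ as₁ → All (_≤ t) as → (∀ {x} → x ∈ as₁ → x ∈ as) →
               top cs as ≡ top cs as₁
top-restrict {as = as} {as₁} cs t∈ ≤t sub = filter-cong-local (above? as) (above? as₁) cs
  (λ _ above → All.tabulate (All.lookup above ∘ sub))
  (λ _ above → All.map (λ a≤t → ≤-<-trans a≤t (All.lookup above t∈)) ≤t)

-- Here m is the least letter of a word of odd length 2k + 5 and lies at an even
-- place, so no replacement brings it to either end.  The lists as and bs contain
-- the odd letters and the even letters other than m.  By weave-to-front-even, m
-- can be put at the second place, leaving the first letter and m in front of a
-- word of length 2k + 3, or at the last place but one.
module LeastAtEvenPlace (m k : ℕ) (connected : Connected (suc (suc k) + suc k)) where

  -- The lengths of as and bs when the first or last odd letter is left out as well.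
  IsShort : List ℕ → List ℕ → Set
  IsShort as bs = length as ≡ suc (suc k) × length bs ≡ suc k

  shorter : ∀ {as bs as′ bs′} → IsShort as bs → Disjoint as bs → Similar as bs as′ bs′ →
            weave as bs ~ weave as′ bs′
  shorter (|as| , |bs|) dis sim =
    connected (cong₂ _+_ |as| |bs|) (inj₂ (trans |as| (cong suc (sym |bs|)))) dis sim

  keep-first : ∀ o {as bs as′ bs′} → IsShort as bs → Disjoint as bs → Similar as bs as′ bs′ →
               weave (o ∷ as) (m ∷ bs) ~ weave (o ∷ as′) (m ∷ bs′)
  keep-first o sh dis sim = ~-∷ o (~-∷ m (shorter sh dis sim))

  move-back : ∀ {as bs o} → IsShort as bs → All (m <_) (as ∷ʳ o) →
              weave (as ∷ʳ o) (m ∷ bs) ~ weave as bs ∷ʳ m ∷ʳ o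
  move-back {as} {bs} {o} (|as| , |bs|) m< = ~-trans
    (~-sym (subst (λ cs → weave (as ∷ʳ o) (bs ∷ʳ m) ~ weave (as ∷ʳ o) (m ∷ cs)) (++-identityʳ bs)
      (weave-to-front-even bs {s = []} m< short)))
    (~-reflexive (trans
      (weave-∷ʳ-odd as (bs ∷ʳ m) (trans one-more (sym (length-∷ʳ bs m))))
      (cong (_∷ʳ o) (weave-∷ʳ-even as bs one-more))))
    where
    one-more : length as ≡ suc (length bs)
    one-more = trans |as| (cong suc (sym |bs|))

    short : length bs < length (as ∷ʳ o)
    short = ≤-trans (≤-reflexive (sym one-more)) (length-++-≤ˡ as)

  keep-last : ∀ o {as bs as′ bs′} → IsShort as bs → Disjoint as bs → All (m <_) (as ∷ʳ o) →
              Similar as bs as′ bs′ →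
              weave (as ∷ʳ o) (m ∷ bs) ~ weave (as′ ∷ʳ o) (m ∷ bs′)
  keep-last o sh@(|as| , |bs|) dis m< sim =
    ~-trans (move-back sh m<)
      (~-trans (~-++ʳ [ o ] (~-++ʳ [ m ] (shorter sh dis sim)))
        (~-sym (move-back
          (trans (sym (↭-length (odd-↭ sim))) |as| , trans (sym (↭-length (even-↭ sim))) |bs|)
          (All-resp-↭ (++⁺ʳ [ o ] (odd-↭ sim)) m<))))

  -- The lengths of as and bs when only m is left out.
  IsLong : List ℕ → List ℕ → Set
  IsLong as bs = length as ≡ suc (suc (suc k)) × length bs ≡ suc k

  -- There are at least three odd letters, so an exchange of two neighbours does not
  -- involve both the first and the last one; the one not involved is kept in place.
  swap-odds : ∀ {as as′ bs} → IsLong as bs → Disjoint as bs → All (m <_) as →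
              Swap (Above bs) as as′ → weave as (m ∷ bs) ~ weave as′ (m ∷ bs)
  swap-odds (|as| , |bs|) dis m< (there {x} r) =
    keep-first x (suc-injective |as| , |bs|) (λ (a∈ , b∈) → dis (there a∈ , b∈)) (swap-similar r)
  swap-odds (|as| , |bs|) dis m< (here {x} {y} {s} ¬both) with initLast s
  swap-odds (() , |bs|) dis m< (here {x} {y} ¬both) | []
  ... | s′ ∷ʳ′ z = keep-last z
    (suc-injective (trans (sym (length-∷ʳ (x ∷ y ∷ s′) z)) |as|) , |bs|)
    (λ (a∈ , b∈) → dis (∈-++⁺ˡ a∈ , b∈)) m< (swap-similar {x ∷ y ∷ s′} (here ¬both))

  rearrange-odds : ∀ {as as′ bs} → IsLong as bs → Disjoint as bs → All (m <_) as →
                   Star (Swap (Above bs)) as as′ → weave as (m ∷ bs) ~ weave as′ (m ∷ bs)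
  rearrange-odds lg dis m< ε = ~-refl
  rearrange-odds lg@(|as| , |bs|) dis m< (r ◅ rs) = ~-trans (swap-odds lg dis m< r)
    (rearrange-odds (trans (sym (↭-length (swap-↭ r))) |as| , |bs|)
      (λ (a∈ , b∈) → dis (∈-resp-↭ (↭-sym (swap-↭ r)) a∈ , b∈))
      (All-resp-↭ (swap-↭ r) m<) rs)

  -- Of the first and the last odd letter, one that is not the greatest is kept in
  -- place; the remaining word has the same top even letters.
  rearrange-evens : ∀ {as bs bs′} → IsLong as bs → Disjoint as bs → All (m <_) as →
                    bs ↭ bs′ → top bs as ≡ top bs′ as →
                    weave as (m ∷ bs) ~ weave as (m ∷ bs′)
  rearrange-evens {o ∷ as} {bs} {bs′} (|as| , |bs|) dis m< p eq with greatest o as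
  ... | t , there t∈ , ≤t =
    keep-first o (suc-injective |as| , |bs|) (λ (a∈ , b∈) → dis (there a∈ , b∈)) record
      { odd-↭ = ↭-refl ; even-↭ = p ; odd-top = top-congʳ as p
      ; even-top = trans (sym (top-restrict bs t∈ ≤t there)) (trans eq (top-restrict bs′ t∈ ≤t there)) }
  ... | t , here refl , ≤t with initLast as
  rearrange-evens {o ∷ _} (() , |bs|) dis m< p eq | t , here refl , ≤t | []
  ... | s ∷ʳ′ z = keep-last z {o ∷ s}
    (suc-injective (trans (sym (length-∷ʳ (o ∷ s) z)) |as|) , |bs|)
    (λ (a∈ , b∈) → dis (∈-++⁺ˡ a∈ , b∈)) m< record
      { odd-↭ = ↭-refl ; even-↭ = p ; odd-top = top-congʳ (o ∷ s) p
      ; even-top = trans (sym (top-restrict bs (here refl) ≤t ∈-++⁺ˡ))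
                     (trans eq (top-restrict bs′ (here refl) ≤t ∈-++⁺ˡ)) }

  rearrange : ∀ {as bs as′ bs′} → IsLong as bs → Disjoint as bs → All (m <_) as →
              Similar as bs as′ bs′ → weave as (m ∷ bs) ~ weave as′ (m ∷ bs′)
  rearrange {as} {bs} {as′} {bs′} lg@(|as| , |bs|) dis m< sim = ~-trans
    (rearrange-evens lg dis m< (even-↭ sim) (trans (even-top sim) (top-congʳ bs′ (↭-sym (odd-↭ sim)))))
    (rearrange-odds (|as| , trans (sym (↭-length (even-↭ sim))) |bs|)
      (λ (a∈ , b∈) → dis (a∈ , ∈-resp-↭ (↭-sym (even-↭ sim)) b∈)) m<
      (swaps-complete (above? bs′) as′ (odd-↭ sim)
        (trans (top-congʳ as (↭-sym (even-↭ sim))) (odd-top sim))))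

-- Similar words are equivalent

length-insert : ∀ {A : Set} p (m : A) s → length (p ++ m ∷ s) ≡ suc (length (p ++ s))
length-insert p m s = ↭-length (shift m p s)

balanced-resp-↭ : ∀ {as bs as′ bs′} → as ↭ as′ → bs ↭ bs′ → Balanced as bs → Balanced as′ bs′
balanced-resp-↭ p q = Sum.map
  (λ eq → trans (sym (↭-length p)) (trans eq (↭-length q)))
  (λ eq → trans (sym (↭-length p)) (trans eq (cong suc (↭-length q))))

balanced-remove : ∀ p m s bs → Balanced (p ++ m ∷ s) bs → Balanced bs (p ++ s)
balanced-remove p m s bs (inj₁ eq) = inj₂ (trans (sym eq) (length-insert p m s))
balanced-remove p m s bs (inj₂ eq) = inj₁ (suc-injective (trans (sym eq) (length-insert p m s)))

split-odd : ∀ p {m} s {bs} → Balanced (p ++ m ∷ s) bs → All (m <_) bs →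
            weave (p ++ m ∷ s) bs ~ m ∷ weave bs (p ++ s)
split-odd p {m} s {bs} bal m<bs = weave-to-front p m<bs
  (≤-trans (length-++-≤ˡ p {s})
    (Sum.[ ≤-reflexive ∘ sym , (λ eq → ≤-trans (n≤1+n _) (≤-reflexive (sym eq))) ]′
      (balanced-remove p m s bs bal)))

-- A letter m below all odd letters becomes the first even letter, which is at the
-- second place of the word.
even-to-front : ∀ p {m} s {as} → length (p ++ m ∷ s) ≤ length as → All (m <_) as →
                weave as (p ++ m ∷ s) ~ weave as (m ∷ p ++ s)
even-to-front p {m} s le m<as = weave-to-front-even p m<as
  (≤-trans (≤-trans (s≤s (length-++-≤ˡ p)) (≤-reflexive (sym (length-insert p m s)))) le)

split-even : ∀ p {m} s {as} → length as ≡ length (p ++ m ∷ s) → All (m <_) as →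
             weave as (p ++ m ∷ s) ~ weave as (p ++ s) ∷ʳ m
split-even p {m} s {as} eq m<as = ~-trans
  (even-to-front p s (≤-reflexive (sym eq)) m<as)
  (~-trans
    (~-sym (subst (λ cs → weave as ((p ++ s) ∷ʳ m) ~ weave as (m ∷ cs)) (++-identityʳ (p ++ s))
      (even-to-front (p ++ s) [] (≤-reflexive (trans (length-∷ʳ (p ++ s) m) (sym one-more))) m<as)))
    (~-reflexive (weave-∷ʳ-even as (p ++ s) one-more)))
  where
  one-more : length as ≡ suc (length (p ++ s))
  one-more = trans eq (length-insert p m s)

∈-remove : ∀ {A : Set} p {m s} {x : A} → x ∈ p ++ s → x ∈ p ++ m ∷ s
∈-remove p x∈ = Sum.[ ∈-++⁺ˡ , ∈-++⁺ʳ p ∘ there ] (∈-++⁻ p x∈)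

strict : ∀ {m cs} → All (m ≤_) cs → (∀ {c} → c ∈ cs → m ≢ c) → All (m <_) cs
strict m≤ m≢ = All.tabulate λ c∈ → ≤∧≢⇒< (All.lookup m≤ c∈) (m≢ c∈)

-- The induction step: removal of the least letter m of the word.
module Induct (N : ℕ) (IH : ∀ {M} → M < N → Connected M) where

  least-odd : ∀ p {m} s p′ s′ {b bs bs′} → b ∈ bs → All (m <_) bs →
              length (p ++ m ∷ s) + length bs ≡ N →
              Balanced (p ++ m ∷ s) bs → Disjoint (p ++ m ∷ s) bs →
              Similar (p ++ m ∷ s) bs (p′ ++ m ∷ s′) bs′ →
              weave (p ++ m ∷ s) bs ~ weave (p′ ++ m ∷ s′) bs′
  least-odd p {m} s p′ s′ {b} {bs} b∈ m<bs size bal dis sim =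
    ~-trans (split-odd p s bal m<bs)
      (~-trans
        (~-∷ m (IH smaller refl (balanced-remove p m s bs bal)
          (λ (b∈ , a∈) → dis (∈-remove p a∈ , b∈))
          (similar-flip (remove-least p s p′ s′ b∈ m<bs sim))))
        (~-sym (split-odd p′ s′ (balanced-resp-↭ (odd-↭ sim) (even-↭ sim) bal)
          (All-resp-↭ (even-↭ sim) m<bs))))
    where
    smaller : length bs + length (p ++ s) < N
    smaller = ≤-reflexive (trans (cong suc (+-comm (length bs) _))
      (trans (cong (_+ length bs) (sym (length-insert p m s))) size))

  least-even : ∀ p {m} s p′ s′ {a as as′} → a ∈ as → All (m <_) as →
               length as + length (p ++ m ∷ s) ≡ N →
               Balanced as (p ++ m ∷ s) → Disjoint as (p ++ m ∷ s) →
               Similar as (p ++ m ∷ s) as′ (p′ ++ m ∷ s′) →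
               weave as (p ++ m ∷ s) ~ weave as′ (p′ ++ m ∷ s′)
  least-even p {m} s p′ s′ {as = as} {as′} a∈ m<as size (inj₁ eq) dis sim =
    ~-trans (split-even p s eq m<as)
      (~-trans
        (~-++ʳ [ m ] (IH smaller refl (inj₂ (trans eq (length-insert p m s)))
          (λ (a∈ , b∈) → dis (a∈ , ∈-remove p b∈))
          (similar-flip (remove-least p s p′ s′ a∈ m<as (similar-flip sim)))))
        (~-sym (split-even p′ s′
          (trans (sym (↭-length (odd-↭ sim))) (trans eq (↭-length (even-↭ sim))))
          (All-resp-↭ (odd-↭ sim) m<as))))
    where
    smaller : length as + length (p ++ s) < N
    smaller = ≤-reflexive (trans (sym (+-suc (length as) _))
      (trans (cong (length as +_) (sym (length-insert p m s))) size))
  least-even p {m} s p′ s′ {as = as} {as′} a∈ m<as size (inj₂ eq) dis sim =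
    ~-trans (even-to-front p s (≤-trans (n≤1+n _) (≤-reflexive (sym eq))) m<as)
      (~-trans (inner (p ++ s) refl)
        (~-sym (even-to-front p′ s′
          (≤-trans (≤-reflexive (sym (↭-length (even-↭ sim))))
            (≤-trans (n≤1+n _) (≤-reflexive (trans (sym eq) (↭-length (odd-↭ sim))))))
          (All-resp-↭ (odd-↭ sim) m<as))))
    where
    rest : Similar as (p ++ s) as′ (p′ ++ s′)
    rest = similar-flip (remove-least p s p′ s′ a∈ m<as (similar-flip sim))

    -- Without even letters other than m all odd letters are top, so both words
    -- are the same.
    inner : ∀ bs → bs ≡ p ++ s → weave as (m ∷ p ++ s) ~ weave as′ (m ∷ p′ ++ s′)
    inner [] e = ~-reflexive (cong₂ weave as≡as′ (cong (m ∷_) (trans (sym e) (sym bs′≡[]))))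
      where
      bs′≡[] : p′ ++ s′ ≡ []
      bs′≡[] = ↭-empty-inv (↭-trans (↭-sym (even-↭ rest)) (↭-reflexive (sym e)))

      top-[] : ∀ cs → top cs [] ≡ cs
      top-[] cs = filter-all (above? []) (All.universal (λ _ → []) cs)

      as≡as′ : as ≡ as′
      as≡as′ = trans (sym (top-[] as)) (trans (cong (top as) e)
        (trans (odd-top rest) (trans (cong (top as′) bs′≡[]) (top-[] as′))))
    inner (b ∷ bs) e = rearrange (|as| , |bs|)
        (λ (a∈ , b∈) → dis (a∈ , ∈-remove p b∈)) m<as rest
      where
      k = length bs

      |bs| : length (p ++ s) ≡ suc k
      |bs| = cong length (sym e)

      |as| : length as ≡ suc (suc (suc k))
      |as| = trans eq (cong suc (trans (length-insert p m s) (cong suc |bs|)))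

      smaller : suc (suc k) + suc k < N
      smaller = ≤-trans (n≤1+n _) (≤-reflexive (trans
        (cong (2 +_) (sym (+-suc (suc k) (suc k))))
        (trans (sym (cong₂ _+_ |as| (trans (length-insert p m s) (cong suc |bs|)))) size)))

      open LeastAtEvenPlace m k (IH smaller)

  remove-either : ∀ {m a b as bs as′ bs′} → a ∈ as → b ∈ bs → m ∈ as ⊎ m ∈ bs →
                  All (m ≤_) as → All (m ≤_) bs → length as + length bs ≡ N →
                  Balanced as bs → Disjoint as bs → Similar as bs as′ bs′ →
                  weave as bs ~ weave as′ bs′
  remove-either _ b∈ (inj₁ m∈as) _ m≤bs size bal dis sim
    with p , s , refl ← ∈-∃++ m∈as | p′ , s′ , refl ← ∈-∃++ (∈-resp-↭ (odd-↭ sim) m∈as)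
    = least-odd p s p′ s′ b∈ (strict m≤bs λ { c∈ refl → dis (m∈as , c∈) }) size bal dis sim
  remove-either a∈ _ (inj₂ m∈bs) m≤as _ size bal dis sim
    with p , s , refl ← ∈-∃++ m∈bs | p′ , s′ , refl ← ∈-∃++ (∈-resp-↭ (even-↭ sim) m∈bs)
    = least-even p s p′ s′ a∈ (strict m≤as λ { c∈ refl → dis (c∈ , m∈bs) }) size bal dis sim

connected-step : ∀ N → (∀ {M} → M < N → Connected M) → Connected N
connected-step N IH {[]} {[]} _ _ _ sim
  rewrite ↭-empty-inv (↭-sym (odd-↭ sim)) | ↭-empty-inv (↭-sym (even-↭ sim)) = ~-refl
connected-step N IH {[]} {_ ∷ _} _ (inj₁ ())
connected-step N IH {[]} {_ ∷ _} _ (inj₂ ())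
connected-step N IH {a ∷ []} {[]} _ _ _ sim
  rewrite ↭-singleton-inv (↭-sym (odd-↭ sim)) | ↭-empty-inv (↭-sym (even-↭ sim)) = ~-refl
connected-step N IH {a ∷ _ ∷ _} {[]} _ (inj₁ ())
connected-step N IH {a ∷ _ ∷ _} {[]} _ (inj₂ ())
connected-step N IH {a ∷ as} {b ∷ bs} size bal dis sim =
  let m , m∈ , m≤ = least a (as ++ b ∷ bs)
  in Induct.remove-either N IH (here refl) (here refl) (∈-++⁻ (a ∷ as) m∈)
       (All.++⁻ˡ (a ∷ as) m≤) (All.++⁻ʳ (a ∷ as) m≤) size bal dis sim

connected : ∀ N → Connected N
connected = <-rec Connected λ N IH → connected-step N (λ lt → IH lt)

swap-weaken : ∀ {A : Set} {P Q : Pred A 0ℓ} {s t} → (∀ {x} → Q x → P x) → Swap P s t → Swap Q s t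
swap-weaken sub (here ¬both) = here λ (qx , qy) → ¬both (sub qx , sub qy)
swap-weaken sub (there r)    = there (swap-weaken sub r)

-- In a factor x y z with y > x or y > z, the letters x and z have the same parity
-- and y the other one, so x and z are not both top.
step-swap : ∀ {v w} → Step v w →
            (Swap (Above (evens v)) (odds v) (odds w) × evens v ≡ evens w) ⊎
            (Swap (Above (odds v)) (evens v) (evens w) × odds v ≡ odds w)
step-swap (here lt) = inj₁ (here (λ { (y<x ∷ _ , y<z ∷ _) → Sum.[ <-asym y<x , <-asym y<z ] lt }) , refl)
step-swap (there {x} r) with step-swap r
... | inj₁ (sw , eq) = inj₂ (swap-weaken All.tail sw , cong (x ∷_) eq)
... | inj₂ (sw , eq) = inj₁ (there sw , eq)

step-similar : ∀ {v w} → Step v w → Similar (odds v) (evens v) (odds w) (evens w)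
step-similar r with step-swap r
... | inj₁ (sw , eq) rewrite sym eq = swap-similar sw
... | inj₂ (sw , eq) rewrite sym eq = similar-flip (swap-similar sw)

similar⇒~ : ∀ {v w} → Disjoint (odds v) (evens v) →
            Similar (odds v) (evens v) (odds w) (evens w) → v ~ w
similar⇒~ {v} {w} dis sim =
  ~-trans (~-reflexive (sym (weave-odds-evens v)))
    (~-trans (connected _ refl (odds-evens-balanced v) dis sim)
      (~-reflexive (weave-odds-evens w)))

-- Rearrangements of the letters 1, …, n

sorted-unique : ∀ {xs ys} → Sorted xs → Sorted ys → xs ↭ ys → xs ≡ ys
sorted-unique xs↗ ys↗ p = ≋⇒≡ (↗↭↗⇒≋ ≤-totalOrder xs↗ ys↗ (↭⇒↭ₛ p))

-- Being a rearrangement is decidable by sorting, hence it can be recovered from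
-- an irrelevant proof.
↭-recompute : ∀ {xs ys : List ℕ} → .(xs ↭ ys) → xs ↭ ys
↭-recompute {xs} {ys} p = ↭-trans (↭-sym (sort-↭ xs)) (↭-trans (↭-reflexive same) (sort-↭ ys))
  where
  same : sort xs ≡ sort ys
  same = recompute (≡-dec _≟_ (sort xs) (sort ys))
    (sorted-unique (sort-↗ xs) (sort-↗ ys)
      (↭-trans (sort-↭ xs) (↭-trans p (↭-sym (sort-↭ ys)))))

drop-++ˡ : ∀ {A : Set} (as : List A) {xs ys} → as ++ xs ↭ as ++ ys → xs ↭ ys
drop-++ˡ []       p = p
drop-++ˡ (a ∷ as) p = drop-++ˡ as (drop-∷ p)

drop-++ʳ : ∀ {A : Set} (bs : List A) {xs ys} → xs ++ bs ↭ ys ++ bs → xs ↭ ys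
drop-++ʳ bs {xs} {ys} p = drop-++ˡ bs (↭-trans (++-comm bs xs) (↭-trans p (++-comm ys bs)))

unique-resp-↭ : ∀ {A : Set} {xs ys : List A} → xs ↭ ys → Unique xs → Unique ys
unique-resp-↭ {A} p = Setoid-↭.Unique-resp-↭ (setoid A) (↭⇒↭ₛ p)

word-↭ : ∀ {n} (φ : Perm n) → toList (word φ) ↭ applyUpTo suc n
word-↭ (perm w p) = ↭-recompute p

applyUpTo-suc-unique : ∀ n → Unique (applyUpTo suc n)
applyUpTo-suc-unique n = Unique.applyUpTo⁺₁ suc n λ i<j _ eq → <⇒≢ i<j (suc-injective eq)

word-unique : ∀ {n} (φ : Perm n) → Unique (toList (word φ))
word-unique φ = unique-resp-↭ (↭-sym (word-↭ φ)) (applyUpTo-suc-unique _)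

-- Order patterns of words of length three

swap₂₃ : ∀ (x y z : ℕ) → x ∷ y ∷ z ∷ [] ↭ x ∷ z ∷ y ∷ []
swap₂₃ x y z = prep x (swap y z ↭-refl)

rotate : ∀ (x y z : ℕ) → x ∷ y ∷ z ∷ [] ↭ y ∷ z ∷ x ∷ []
rotate x y z = ++-comm (x ∷ []) (y ∷ z ∷ [])

reverse₃ : ∀ (x y z : ℕ) → x ∷ y ∷ z ∷ [] ↭ z ∷ y ∷ x ∷ []
reverse₃ x y z = ↭-sym (↭-reverse (x ∷ y ∷ z ∷ []))

-- For a permutation σ, SameOrder (word σ) u is IsOrderPermutation σ u.
SameOrder : ∀ {c} → Vec ℕ c → Vec ℕ c → Set
SameOrder u v = ∀ i j → (lookup u i < lookup u j) ⇔ (lookup v i < lookup v j)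

same-order-≤ : ∀ {c} (u v : Vec ℕ c) → SameOrder u v → ∀ i j →
               lookup u i ≤ lookup u j → lookup v i ≤ lookup v j
same-order-≤ u v so i j le = ≮⇒≥ λ gt → <⇒≱ (Equivalence.from (so j i) gt) le

sorted₃ : ∀ {x y z x′ y′ z′ : ℕ} → x ≤ y → y ≤ z → x′ ≤ y′ → y′ ≤ z′ →
          x ∷ y ∷ z ∷ [] ↭ x′ ∷ y′ ∷ z′ ∷ [] → x ≡ x′ × y ≡ y′ × z ≡ z′
sorted₃ xy yz xy′ yz′ p with refl ← sorted-unique (xy ∷ yz ∷ [-]) (xy′ ∷ yz′ ∷ [-]) p =
  refl , refl , refl

vec₃ : ∀ {x y z x′ y′ z′ : ℕ} → x ≡ x′ → y ≡ y′ → z ≡ z′ →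
       Vec._∷_ x (y ∷ z ∷ []) ≡ x′ ∷ y′ ∷ z′ ∷ []
vec₃ refl refl refl = refl

-- Sorting both words by the same rearrangement of places makes them equal.
same-order-≡ : ∀ (u v : Vec ℕ 3) → SameOrder u v → toList u ↭ toList v → u ≡ v
same-order-≡ u@(x ∷ y ∷ z ∷ []) v@(x′ ∷ y′ ∷ z′ ∷ []) so p =
  cases (≤-total x y) (≤-total y z) (≤-total x z)
  where
  t = same-order-≤ u v so

  cases : x ≤ y ⊎ y ≤ x → y ≤ z ⊎ z ≤ y → x ≤ z ⊎ z ≤ x → u ≡ v
  cases (inj₁ xy) (inj₁ yz) _ =
    let ex , ey , ez = sorted₃ xy yz (t 0F 1F xy) (t 1F 2F yz) p
    in vec₃ ex ey ez
  cases (inj₁ xy) (inj₂ zy) (inj₁ xz) =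
    let ex , ez , ey = sorted₃ xz zy (t 0F 2F xz) (t 2F 1F zy)
                         (↭-trans (swap₂₃ x z y) (↭-trans p (swap₂₃ x′ y′ z′)))
    in vec₃ ex ey ez
  cases (inj₁ xy) (inj₂ zy) (inj₂ zx) =
    let ez , ex , ey = sorted₃ zx xy (t 2F 0F zx) (t 0F 1F xy)
                         (↭-trans (rotate z x y) (↭-trans p (↭-sym (rotate z′ x′ y′))))
    in vec₃ ex ey ez
  cases (inj₂ yx) (inj₁ yz) (inj₁ xz) =
    let ey , ex , ez = sorted₃ yx xz (t 1F 0F yx) (t 0F 2F xz)
                         (↭-trans (swap y x ↭-refl) (↭-trans p (swap x′ y′ ↭-refl)))
    in vec₃ ex ey ez
  cases (inj₂ yx) (inj₁ yz) (inj₂ zx) =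
    let ey , ez , ex = sorted₃ yz zx (t 1F 2F yz) (t 2F 0F zx)
                         (↭-trans (↭-sym (rotate x y z)) (↭-trans p (rotate x′ y′ z′)))
    in vec₃ ex ey ez
  cases (inj₂ yx) (inj₂ zy) _ =
    let ez , ey , ex = sorted₃ zy yx (t 2F 1F zy) (t 1F 0F yx)
                         (↭-trans (reverse₃ z y x) (↭-trans p (reverse₃ x′ y′ z′)))
    in vec₃ ex ey ez

~-context : ∀ a {u v : List ℕ} {b} → u ~ v → a ++ u ++ b ~ a ++ v ++ b
~-context []      {b = b} r = ~-++ʳ b r
~-context (x ∷ a)         r = ~-∷ x (~-context a r)

pattern-≤ : ∀ {c} (σ : Perm c) (u : Vec ℕ c) → IsOrderPermutation σ u → ∀ i j →
           lookup (word σ) i < lookup (word σ) j → lookup u i ≤ lookup u j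
pattern-≤ σ u o i j lt = <⇒≤ (Equivalence.to (o i j) lt)

reversed-~ : ∀ {x y z x′ y′ z′} → x ≡ z′ → y ≡ y′ → z ≡ x′ → x < y ⊎ z < y →
             x ∷ y ∷ z ∷ [] ~ x′ ∷ y′ ∷ z′ ∷ []
reversed-~ refl refl refl lt = Eq.return (here lt)

same-pattern-~ : ∀ (σ : Perm 3) (u v : Vec ℕ 3) → toList u ↭ toList v →
                 IsOrderPermutation σ u → IsOrderPermutation σ v → toList u ~ toList v
same-pattern-~ σ u v p ou ov = ~-reflexive (cong toList
  (same-order-≡ u v (λ i j → mk⇔ (Equivalence.to (ov i j) ∘ Equivalence.from (ou i j))
                                 (Equivalence.to (ou i j) ∘ Equivalence.from (ov i j))) p))

-- Two rearrangements of the same three letters whose patterns lie in the same part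
-- are equal if the patterns are equal; otherwise each is the reverse of the other.
part-~ : ∀ (u v : Vec ℕ 3) {σ τ} → toList u ↭ toList v →
         IsOrderPermutation σ u → IsOrderPermutation τ v → SamePart K₀ σ τ →
         toList u ~ toList v
part-~ u v {σ} p ou ov (inj₁ refl) = same-pattern-~ σ u v p ou ov
part-~ u v p ou ov (inj₂ (here (here refl , here refl))) = same-pattern-~ p123 u v p ou ov
part-~ u v p ou ov (inj₂ (here (there (here refl) , there (here refl)))) = same-pattern-~ p321 u v p ou ov
part-~ u v p ou ov (inj₂ (there (here (here refl , here refl)))) = same-pattern-~ p132 u v p ou ov
part-~ u v p ou ov (inj₂ (there (here (there (here refl) , there (here refl))))) = same-pattern-~ p231 u v p ou ov
part-~ u@(x ∷ y ∷ z ∷ []) v@(x′ ∷ y′ ∷ z′ ∷ []) p ou ov (inj₂ (here (here refl , there (here refl)))) =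
  let ex , ey , ez = sorted₃
        (pattern-≤ p123 u ou 0F 1F (n<1+n 1)) (pattern-≤ p123 u ou 1F 2F (n<1+n 2))
        (pattern-≤ p321 v ov 2F 1F (n<1+n 1)) (pattern-≤ p321 v ov 1F 0F (n<1+n 2))
        (↭-trans p (reverse₃ x′ y′ z′))
  in reversed-~ ex ey ez (inj₁ (Equivalence.to (ou 0F 1F) (n<1+n 1)))
part-~ u@(x ∷ y ∷ z ∷ []) v@(x′ ∷ y′ ∷ z′ ∷ []) p ou ov (inj₂ (here (there (here refl) , here refl))) =
  let ez , ey , ex = sorted₃
        (pattern-≤ p321 u ou 2F 1F (n<1+n 1)) (pattern-≤ p321 u ou 1F 0F (n<1+n 2))
        (pattern-≤ p123 v ov 0F 1F (n<1+n 1)) (pattern-≤ p123 v ov 1F 2F (n<1+n 2))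
        (↭-trans (reverse₃ z y x) p)
  in reversed-~ ex ey ez (inj₂ (Equivalence.to (ou 2F 1F) (n<1+n 1)))
part-~ u@(x ∷ y ∷ z ∷ []) v@(x′ ∷ y′ ∷ z′ ∷ []) p ou ov (inj₂ (there (here (here refl , there (here refl))))) =
  let ex , ez , ey = sorted₃
        (pattern-≤ p132 u ou 0F 2F (n<1+n 1)) (pattern-≤ p132 u ou 2F 1F (n<1+n 2))
        (pattern-≤ p231 v ov 2F 0F (n<1+n 1)) (pattern-≤ p231 v ov 0F 1F (n<1+n 2))
        (↭-trans (swap₂₃ x z y) (↭-trans p (↭-sym (rotate z′ x′ y′))))
  in reversed-~ ex ey ez (inj₂ (Equivalence.to (ou 2F 1F) (n<1+n 2)))
part-~ u@(x ∷ y ∷ z ∷ []) v@(x′ ∷ y′ ∷ z′ ∷ []) p ou ov (inj₂ (there (here (there (here refl) , here refl)))) =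
  let ez , ex , ey = sorted₃
        (pattern-≤ p231 u ou 2F 0F (n<1+n 1)) (pattern-≤ p231 u ou 0F 1F (n<1+n 2))
        (pattern-≤ p132 v ov 0F 2F (n<1+n 1)) (pattern-≤ p132 v ov 2F 1F (n<1+n 2))
        (↭-trans (rotate z x y) (↭-trans p (swap₂₃ x′ y′ z′)))
  in reversed-~ ex ey ez (inj₁ (Equivalence.to (ou 0F 1F) (n<1+n 2)))

replacement⇒~ : ∀ {n} {φ ψ : Perm n} → Replacement K₀ φ ψ → toList (word φ) ~ toList (word ψ)
replacement⇒~ {φ = φ} {ψ} (replace a b u v σ τ eqφ eqψ ou ov same) =
  subst₂ _~_ (sym eqφ) (sym eqψ) (~-context a (part-~ u v u↭v ou ov same))
  where
  u↭v : toList u ↭ toList v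
  u↭v = drop-++ʳ b (drop-++ˡ a (subst₂ _↭_ eqφ eqψ (↭-trans (word-↭ φ) (↭-sym (word-↭ ψ)))))

-- Equivalence of permutations and of their words

-- The letters a and b are distinct and in the same order as x and y.
Agree : ℕ → ℕ → ℕ → ℕ → Set
Agree a b x y = (a < b × x < y) ⊎ (b < a × y < x)

agree-⇔ : ∀ {a b x y} → Agree a b x y → (a < b) ⇔ (x < y)
agree-⇔ (inj₁ (a<b , x<y)) = mk⇔ (λ _ → x<y) (λ _ → a<b)
agree-⇔ (inj₂ (b<a , y<x)) = mk⇔ (λ a<b → contradiction b<a (<-asym a<b))
                                 (λ x<y → contradiction y<x (<-asym x<y))

agree-sym : ∀ {a b x y} → Agree a b x y → Agree b a y x
agree-sym = Sum.swap

same-order₃ : ∀ {a b c x y z} → Agree a b x y → Agree b c y z → Agree a c x z →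
              SameOrder (a ∷ b ∷ c ∷ []) (x ∷ y ∷ z ∷ [])
same-order₃ ab bc ac 0F 0F = mk⇔ (⊥-elim ∘ <-irrefl refl) (⊥-elim ∘ <-irrefl refl)
same-order₃ ab bc ac 0F 1F = agree-⇔ ab
same-order₃ ab bc ac 0F 2F = agree-⇔ ac
same-order₃ ab bc ac 1F 0F = agree-⇔ (agree-sym ab)
same-order₃ ab bc ac 1F 1F = mk⇔ (⊥-elim ∘ <-irrefl refl) (⊥-elim ∘ <-irrefl refl)
same-order₃ ab bc ac 1F 2F = agree-⇔ bc
same-order₃ ab bc ac 2F 0F = agree-⇔ (agree-sym ac)
same-order₃ ab bc ac 2F 1F = agree-⇔ (agree-sym bc)
same-order₃ ab bc ac 2F 2F = mk⇔ (⊥-elim ∘ <-irrefl refl) (⊥-elim ∘ <-irrefl refl)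

private
  1<2 : 1 < 2
  1<2 = n<1+n 1
  2<3 : 2 < 3
  2<3 = n<1+n 2
  1<3 : 1 < 3
  1<3 = s≤s (s≤s z≤n)

is123 : ∀ {x y z} → x < y → y < z → IsOrderPermutation p123 (x ∷ y ∷ z ∷ [])
is123 xy yz = same-order₃ (inj₁ (1<2 , xy)) (inj₁ (2<3 , yz)) (inj₁ (1<3 , <-trans xy yz))

is321 : ∀ {x y z} → z < y → y < x → IsOrderPermutation p321 (x ∷ y ∷ z ∷ [])
is321 zy yx = same-order₃ (inj₂ (2<3 , yx)) (inj₂ (1<2 , zy)) (inj₂ (1<3 , <-trans zy yx))

is132 : ∀ {x y z} → x < z → z < y → IsOrderPermutation p132 (x ∷ y ∷ z ∷ [])
is132 xz zy = same-order₃ (inj₁ (1<3 , <-trans xz zy)) (inj₂ (2<3 , zy)) (inj₁ (1<2 , xz))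

is231 : ∀ {x y z} → z < x → x < y → IsOrderPermutation p231 (x ∷ y ∷ z ∷ [])
is231 zx xy = same-order₃ (inj₁ (2<3 , xy)) (inj₂ (1<3 , <-trans zx xy)) (inj₂ (1<2 , zx))

-- The order of x, y and z determines which of the four patterns is replaced.
step⇒replacement : ∀ {n} {φ ψ : Perm n} a {b x y z} →
  toList (word φ) ≡ a ++ x ∷ y ∷ z ∷ b → toList (word ψ) ≡ a ++ z ∷ y ∷ x ∷ b →
  y ≢ x → y ≢ z → x ≢ z → x < y ⊎ z < y → Replacement K₀ φ ψ
step⇒replacement a {b} {x} {y} {z} eqφ eqψ y≢x y≢z x≢z lt with <-cmp y x | <-cmp y z | <-cmp x z
... | tri≈ _ eq _ | _ | _ = contradiction eq y≢x
... | _ | tri≈ _ eq _ | _ = contradiction eq y≢z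
... | _ | _ | tri≈ _ eq _ = contradiction eq x≢z
... | tri< yx _ _ | tri< yz _ _ | _ = contradiction lt Sum.[ <-asym yx , <-asym yz ]
... | tri> _ _ xy | tri< yz _ _ | _ =
  replace a b (x ∷ y ∷ z ∷ []) (z ∷ y ∷ x ∷ []) p123 p321 eqφ eqψ (is123 xy yz) (is321 xy yz)
    (inj₂ (here (here refl , there (here refl))))
... | tri< yx _ _ | tri> _ _ zy | _ =
  replace a b (x ∷ y ∷ z ∷ []) (z ∷ y ∷ x ∷ []) p321 p123 eqφ eqψ (is321 zy yx) (is123 zy yx)
    (inj₂ (here (there (here refl) , here refl)))
... | tri> _ _ xy | tri> _ _ zy | tri< xz _ _ =
  replace a b (x ∷ y ∷ z ∷ []) (z ∷ y ∷ x ∷ []) p132 p231 eqφ eqψ (is132 xz zy) (is231 xz zy)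
    (inj₂ (there (here (here refl , there (here refl)))))
... | tri> _ _ xy | tri> _ _ zy | tri> _ _ zx =
  replace a b (x ∷ y ∷ z ∷ []) (z ∷ y ∷ x ∷ []) p231 p132 eqφ eqψ (is231 zx xy) (is132 zx xy)
    (inj₂ (there (here (there (here refl) , here refl))))

step-factor : ∀ {v w} → Step v w → Unique v →
  ∃ λ a → ∃ λ b → ∃ λ x → ∃ λ y → ∃ λ z →
    v ≡ a ++ x ∷ y ∷ z ∷ b × w ≡ a ++ z ∷ y ∷ x ∷ b ×
    y ≢ x × y ≢ z × x ≢ z × (x < y ⊎ z < y)
step-factor (here {x} {y} {z} {w} lt) ((x≢y ∷ x≢z ∷ _) ∷ (y≢z ∷ _) ∷ _) =
  [] , w , x , y , z , refl , refl , x≢y ∘ sym , y≢z , x≢z , lt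
step-factor (there {c} r) (_ ∷ uniq) =
  let a , b , x , y , z , eq , eq′ , rest = step-factor r uniq
  in c ∷ a , b , x , y , z , cong (c ∷_) eq , cong (c ∷_) eq′ , rest

step-↭ : ∀ {v w} → Step v w → v ↭ w
step-↭ (here {x} {y} {z} {w} _) = ++⁺ʳ w (reverse₃ x y z)
step-↭ (there r) = prep _ (step-↭ r)

perm-step : ∀ {n} {φ ψ : Perm n} {v w} → toList (word φ) ≡ v → toList (word ψ) ≡ w →
            Step v w → Replacement K₀ φ ψ
perm-step {φ = φ} φ≡v ψ≡w r =
  let a , b , x , y , z , v≡ , w≡ , y≢x , y≢z , x≢z , lt =
        step-factor r (subst Unique φ≡v (word-unique φ))
  in step⇒replacement a (trans φ≡v v≡) (trans ψ≡w w≡) y≢x y≢z x≢z lt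

perm-≡ : ∀ {n} {φ ψ : Perm n} → toList (word φ) ≡ toList (word ψ) → φ ≡ ψ
perm-≡ {φ = perm u _} {perm v _} eq
  with refl ← trans (sym (Vec.cast-is-id refl u)) (Vec.toList-injective refl u v eq) = refl

from-word : ∀ {n} (w : List ℕ) → .(w ↭ applyUpTo suc n) → ∃ λ (φ : Perm n) → toList (word φ) ≡ w
from-word {n} w p = perm (Vec.cast |w| (fromList w)) (↭-trans (↭-reflexive same) p) , same
  where
  |w| : length w ≡ n
  |w| = trans (↭-length (↭-recompute p)) (length-applyUpTo suc n)

  same : toList (Vec.cast |w| (fromList w)) ≡ w
  same = trans (Vec.toList-cast |w| (fromList w)) (Vec.toList∘fromList w)

~⇒≈ : ∀ {n} {φ ψ : Perm n} → toList (word φ) ~ toList (word ψ) → Setoid._≈_ (S[ n ]/ K₀) φ ψ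
~⇒≈ {n} {φ} {ψ} = lift {φ} refl
  where
  lift : ∀ {φ v} → toList (word φ) ≡ v → v ~ toList (word ψ) → Setoid._≈_ (S[ n ]/ K₀) φ ψ
  lift {φ} eq ε = Setoid.reflexive (S[ n ]/ K₀) (perm-≡ {φ = φ} {ψ} eq)
  lift {φ} eq (_◅_ {j = w} (fwd r) rs) =
    let χ , χ-eq = from-word {n} w (↭-trans (↭-sym (step-↭ r)) (subst (_↭ applyUpTo suc n) eq (word-↭ φ)))
    in fwd (perm-step {φ = φ} {χ} eq χ-eq r) ◅ lift {χ} χ-eq rs
  lift {φ} eq (_◅_ {j = w} (bwd r) rs) =
    let χ , χ-eq = from-word {n} w (↭-trans (step-↭ r) (subst (_↭ applyUpTo suc n) eq (word-↭ φ)))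
    in bwd (perm-step {φ = χ} {φ} χ-eq eq r) ◅ lift {χ} χ-eq rs

≈⇒~ : ∀ {n} {φ ψ : Perm n} → Setoid._≈_ (S[ n ]/ K₀) φ ψ → toList (word φ) ~ toList (word ψ)
≈⇒~ = Eq.gfold (Eq.isEquivalence Step) (toList ∘ word) replacement⇒~

-- Counting the elements of a predicate

-- A duplicate-free enumeration of P with n entries.
record Count {A : Set} (P : A → Set) (n : ℕ) : Set where
  field
    elements : List A
    unique   : Unique elements
    size     : length elements ≡ n
    sound    : ∀ {a} → a ∈ elements → P a
    complete : ∀ {a} → P a → a ∈ elements

open Count

module _ {A : Set} where

  count-list : ∀ {xs : List A} → Unique xs → Count (_∈ xs) (length xs)
  count-list {xs} u = record
    { elements = xs ; unique = u ; size = refl ; sound = id ; complete = id }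

  count-⇔ : ∀ {P Q : A → Set} {n} → (∀ {a} → P a → Q a) → (∀ {a} → Q a → P a) →
            Count P n → Count Q n
  count-⇔ to from c = record
    { elements = elements c ; unique = unique c ; size = size c
    ; sound = to ∘ sound c ; complete = complete c ∘ from }

  count-cast : ∀ {P : A → Set} {m n} → m ≡ n → Count P m → Count P n
  count-cast refl c = c

  count-⊎ : ∀ {P Q : A → Set} {m n} → (∀ {a} → P a → Q a → ⊥) →
            Count P m → Count Q n → Count (λ a → P a ⊎ Q a) (m + n)
  count-⊎ disjoint c d = record
    { elements = elements c ++ elements d
    ; unique   = Unique.++⁺ (unique c) (unique d) λ (a∈c , a∈d) → disjoint (sound c a∈c) (sound d a∈d)
    ; size     = trans (length-++ (elements c)) (cong₂ _+_ (size c) (size d))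
    ; sound    = Sum.map (sound c) (sound d) ∘ ∈-++⁻ (elements c)
    ; complete = Sum.[ ∈-++⁺ˡ ∘ complete c , ∈-++⁺ʳ (elements c) ∘ complete d ]
    }

unique-map : ∀ {A B : Set} (f : A → B) {xs} →
             (∀ {a a′} → a ∈ xs → a′ ∈ xs → f a ≡ f a′ → a ≡ a′) →
             Unique xs → Unique (map f xs)
unique-map f inj []         = []
unique-map f inj (x∉ ∷ u) =
  All.map⁺ (All.tabulate λ a∈ eq → All.lookup x∉ a∈ (inj (here refl) (there a∈) eq))
  ∷ unique-map f (λ a∈ a′∈ → inj (there a∈) (there a′∈)) u

count-map : ∀ {A B : Set} {P : A → Set} {n} (f : A → B) →
            (∀ {a a′} → P a → P a′ → f a ≡ f a′ → a ≡ a′) →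
            Count P n → Count (λ b → ∃ λ a → P a × b ≡ f a) n
count-map f inj c = record
  { elements = map f (elements c)
  ; unique   = unique-map f (λ a∈ a′∈ → inj (sound c a∈) (sound c a′∈)) (unique c)
  ; size     = trans (length-map f (elements c)) (size c)
  ; sound    = λ b∈ → let a , a∈ , eq = ∈-map⁻ f b∈ in a , sound c a∈ , eq
  ; complete = λ { (a , pa , refl) → ∈-map⁺ f (complete c pa) }
  }

-- Dependent pairs with the first component in a list xs.
count-Σ : ∀ {A B : Set} {Q : A → B → Set} {f : A → ℕ} xs → Unique xs →
          (∀ {a} → a ∈ xs → Count (Q a) (f a)) →
          Count {A × B} (λ (a , b) → a ∈ xs × Q a b) (sum (map f xs))
count-Σ []       _          cs = record
  { elements = [] ; unique = [] ; size = refl ; sound = λ () ; complete = λ () }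
count-Σ {Q = Q} (x ∷ xs) (x∉ ∷ u) cs = count-⇔ to from
  (count-⊎ (λ (b , q , eq) (a∈ , _) → All.lookup x∉ a∈ (sym (cong proj₁ eq)))
    (count-map (x ,_) (λ _ _ → λ { refl → refl }) (cs (here refl)))
    (count-Σ xs u (cs ∘ there)))
  where
  to : ∀ {ab} → (∃ λ b → Q x b × ab ≡ (x , b)) ⊎ (proj₁ ab ∈ xs × Q (proj₁ ab) (proj₂ ab)) →
       proj₁ ab ∈ x ∷ xs × Q (proj₁ ab) (proj₂ ab)
  to (inj₁ (b , q , refl)) = here refl , q
  to (inj₂ (a∈ , q))       = there a∈ , q

  from : ∀ {ab} → proj₁ ab ∈ x ∷ xs × Q (proj₁ ab) (proj₂ ab) →
         (∃ λ b → Q x b × ab ≡ (x , b)) ⊎ (proj₁ ab ∈ xs × Q (proj₁ ab) (proj₂ ab))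
  from (here refl , q) = inj₁ (_ , q , refl)
  from (there a∈ , q)  = inj₂ (a∈ , q)

sum-const : ∀ {A : Set} k (xs : List A) → sum (map (const k) xs) ≡ length xs * k
sum-const k []       = refl
sum-const k (x ∷ xs) = cong (k +_) (sum-const k xs)

-- Dependent pairs with fibres of constant size.
count-× : ∀ {A B : Set} {P : A → Set} {Q : A → B → Set} {m n} → Count P m →
          (∀ {a} → P a → Count (Q a) n) → Count {A × B} (λ (a , b) → P a × Q a b) (m * n)
count-× {n = n} c d = count-⇔ (Product.map₁ (sound c)) (Product.map₁ (complete c))
  (count-cast (trans (sum-const n (elements c)) (cong (_* n) (size c)))
    (count-Σ (elements c) (unique c) (d ∘ sound c)))

-- A rearrangement is a first letter together with a rearrangement of the rest.
count-rearrangements : ∀ {A : Set} k {xs : List A} → length xs ≡ k → Unique xs → Count (_↭ xs) (k !)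
count-rearrangements zero    {[]} _ _ =
  count-⇔ (λ { (here refl) → ↭-refl ; (there ()) }) (here ∘ ↭-empty-inv) (count-list ([] ∷ []))
count-rearrangements {A} (suc k) {xs} |xs| u = count-⇔ to from
  (count-map (λ (y , ys) → y ∷ ys) (λ { _ _ refl → refl })
    (count-cast (cong (_* k !) |xs|) (count-× (count-list u) after)))
  where
  after : ∀ {y} → y ∈ xs → Count (λ ys → y ∷ ys ↭ xs) (k !)
  after {y} y∈ with p , s , refl ← ∈-∃++ y∈ = count-⇔
    (λ q → ↭-trans (prep y q) (↭-sym (shift y p s)))
    (λ q → drop-∷ (↭-trans q (shift y p s)))
    (count-rearrangements k (suc-injective (trans (sym (length-insert p y s)) |xs|))
      (unique-remove p u))
    where
    unique-remove : ∀ p {y s} → Unique (p ++ y ∷ s) → Unique (p ++ s)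
    unique-remove []      (_ ∷ u)  = u
    unique-remove (x ∷ p) (x∉ ∷ u) = All.++⁺ (All.++⁻ˡ p x∉) (All.tail (All.++⁻ʳ p x∉)) ∷ unique-remove p u

  to : ∀ {zs} → (∃ λ (yys : A × List A) → (proj₁ yys ∈ xs × proj₁ yys ∷ proj₂ yys ↭ xs) ×
                 zs ≡ proj₁ yys ∷ proj₂ yys) → zs ↭ xs
  to (_ , (_ , p) , refl) = p

  from : ∀ {zs} → zs ↭ xs → ∃ λ (yys : A × List A) →
         (proj₁ yys ∈ xs × proj₁ yys ∷ proj₂ yys ↭ xs) × zs ≡ proj₁ yys ∷ proj₂ yys
  from {[]}     p with () ← trans (↭-length p) |xs|
  from {z ∷ zs} p = (z , zs) , (∈-resp-↭ p (here refl) , p) , refl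

-- Disjoint unions over i < m.
count-⋃ : ∀ {A : Set} {Q : ℕ → A → Set} m {f} → (∀ {i} → i < m → Count (Q i) (f i)) →
          (∀ {i j a} → Q i a → Q j a → i ≡ j) →
          Count (λ a → ∃ λ i → i < m × Q i a) (sum (applyUpTo f m))
count-⋃ {A} {Q} m {f} cs disjoint = count-⇔
  (λ { ((i , a) , (i∈ , q) , refl) → i , ∈-upTo⁻ i∈ , q })
  (λ (i , i<m , q) → (i , _) , (∈-upTo⁺ i<m , q) , refl)
  (count-map proj₂ (λ { (_ , q) (_ , q′) refl → cong (_, _) (disjoint q q′) })
    (count-cast (cong sum (map-upTo f m))
      (count-Σ (upTo m) (Unique.upTo⁺ m) (cs ∘ ∈-upTo⁻))))

index-unique : ∀ {A : Set} {xs : List A} {a} → Unique xs → (p : a ∈ xs) →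
               ∀ i → a ≡ List.lookup xs i → index p ≡ i
index-unique u          (here refl) zero    eq = refl
index-unique (x∉ ∷ u)   (here refl) (suc i) eq = contradiction eq (All.lookup x∉ (∈-lookup i))
index-unique (x∉ ∷ u)   (there p)   zero    eq = contradiction (sym eq) (All.lookup x∉ p)
index-unique (x∉ ∷ u)   (there p)   (suc i) eq = cong suc (index-unique u p i eq)

-- Equivalence classes are in bijection with the values of a complete invariant.
count-bijection : ∀ {c ℓ} {K : Set} {P : K → Set} {N} (S : Setoid c ℓ) (let open Setoid S using (Carrier; _≈_)) →
                  Count P N → (key : Carrier → K) → (∀ x → P (key x)) →
                  (∀ {x y} → x ≈ y → key x ≡ key y) → (∀ {x y} → key x ≡ key y → x ≈ y) →
                  (∀ {k} → P k → ∃ λ x → key x ≡ k) →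
                  Bijection S (setoid (Fin N))
count-bijection S record { elements = ks ; unique = u ; size = refl ; sound = sound ; complete = complete }
                key valid key-cong key-injective key-surjective = record
  { to        = to
  ; cong      = to-cong
  ; bijective = (λ {x} {y} eq → key-injective (trans (lookup-index (place x))
                  (trans (cong (List.lookup ks) eq) (sym (lookup-index (place y))))))
              , λ i → let x , eq = key-surjective (sound (∈-lookup {xs = ks} i))
                      in x , λ {z} z≈x → index-unique u (place z) i (trans (key-cong z≈x) eq)
  }
  where
  open Setoid S using (Carrier; _≈_)
  place : ∀ x → key x ∈ ks
  place x = complete (valid x)

  to : Carrier → Fin (length ks)
  to x = index (place x)

  to-cong : ∀ {x y} → x ≈ y → to x ≡ to y
  to-cong {x} {y} x≈y = index-unique u (place x) (to y) (trans (key-cong x≈y) (lookup-index (place y)))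

-- Distributions of the letters over the two parities

-- A distribution of the letters 1, …, n is a list s of n booleans whose entries
-- belong to the letters n, …, 1 in this order: true for a letter at an odd place,
-- false for a letter at an even place.  lettersOn c s lists the letters with
-- entry c in decreasing order.
lettersOn : Bool → List Bool → List ℕ
lettersOn c []      = []
lettersOn c (d ∷ s) = if does (c ≟ᵇ d) then suc (length s) ∷ lettersOn c s else lettersOn c s

letters-same : ∀ b s → lettersOn b (b ∷ s) ≡ suc (length s) ∷ lettersOn b s
letters-same true  s = refl
letters-same false s = refl

letters-skip : ∀ b s → lettersOn b (not b ∷ s) ≡ lettersOn b s
letters-skip true  s = refl
letters-skip false s = refl

letters-other : ∀ b s → lettersOn (not b) (b ∷ s) ≡ lettersOn (not b) s
letters-other true  s = refl
letters-other false s = refl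

letters-≤ : ∀ c s → All (_≤ length s) (lettersOn c s)
letters-≤ c []      = []
letters-≤ c (d ∷ s) with does (c ≟ᵇ d)
... | true  = ≤-refl ∷ All.map m≤n⇒m≤1+n (letters-≤ c s)
... | false = All.map m≤n⇒m≤1+n (letters-≤ c s)

letters-↭ : ∀ b s → lettersOn b s ++ lettersOn (not b) s ↭ applyUpTo suc (length s)
letters-↭ b []      = ↭-refl
letters-↭ b (d ∷ s) = ↭-trans (extract b d) (↭-trans (prep _ (letters-↭ b s))
  (↭-trans (∷↭∷ʳ (suc (length s)) (applyUpTo suc (length s)))
    (↭-reflexive (applyUpTo-∷ʳ suc (length s)))))
  where
  extract : ∀ b d → lettersOn b (d ∷ s) ++ lettersOn (not b) (d ∷ s) ↭
                    suc (length s) ∷ lettersOn b s ++ lettersOn (not b) s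
  extract true  true  = ↭-refl
  extract true  false = shift _ (lettersOn true s) _
  extract false true  = shift _ (lettersOn false s) _
  extract false false = ↭-refl

letters-length : ∀ b s → length (lettersOn b s) + length (lettersOn (not b) s) ≡ length s
letters-length b s = trans (sym (length-++ (lettersOn b s)))
  (trans (↭-length (letters-↭ b s)) (length-applyUpTo suc (length s)))

count-sides : ∀ c m k → Count (λ s → length s ≡ m × length (lettersOn c s) ≡ k) (m C k)
count-sides c zero zero = count-⇔
  (λ { (here refl) → refl , refl ; (there ()) }) (λ { {[]} _ → here refl ; {_ ∷ _} (() , _) })
  (count-list {xs = [] ∷ []} ([] ∷ []))
count-sides c zero (suc k) = count-⇔ (λ ()) (λ { {[]} (_ , ()) ; {_ ∷ _} (() , _) }) (count-list {xs = []} [])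
count-sides c (suc m) zero = count-⇔ to from
  (count-map (not c ∷_) (λ { _ _ refl → refl }) (count-sides c m zero))
  where
  to : ∀ {s} → (∃ λ t → (length t ≡ m × length (lettersOn c t) ≡ 0) × s ≡ not c ∷ t) →
       length s ≡ suc m × length (lettersOn c s) ≡ 0
  to (t , (|t| , eq) , refl) = cong suc |t| , trans (cong length (letters-skip c t)) eq

  from : ∀ {s} → length s ≡ suc m × length (lettersOn c s) ≡ 0 →
         ∃ λ t → (length t ≡ m × length (lettersOn c t) ≡ 0) × s ≡ not c ∷ t
  from {d ∷ s} (|s| , eq) with c ≟ᵇ d
  ... | no c≢d = s , (suc-injective |s| , eq) , cong (_∷ s) (¬-not (c≢d ∘ sym))
  from {d ∷ s} (|s| , ()) | yes _
count-sides c (suc m) (suc k) = count-cast (nCk+nC[k+1]≡[n+1]C[k+1] m k) (count-⇔ to from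
  (count-⊎ (λ { (_ , _ , refl) (_ , _ , eq) → not-¬ {c} refl (∷-injectiveˡ eq) })
    (count-map (c ∷_) (λ { _ _ refl → refl }) (count-sides c m k))
    (count-map (not c ∷_) (λ { _ _ refl → refl }) (count-sides c m (suc k)))))
  where
  Q : ℕ → List Bool → Set
  Q k t = length t ≡ m × length (lettersOn c t) ≡ k

  to : ∀ {s} → (∃ λ t → Q k t × s ≡ c ∷ t) ⊎ (∃ λ t → Q (suc k) t × s ≡ not c ∷ t) →
       length s ≡ suc m × length (lettersOn c s) ≡ suc k
  to (inj₁ (t , (|t| , eq) , refl)) = cong suc |t| , trans (cong length (letters-same c t)) (cong suc eq)
  to (inj₂ (t , (|t| , eq) , refl)) = cong suc |t| , trans (cong length (letters-skip c t)) eq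

  from : ∀ {s} → length s ≡ suc m × length (lettersOn c s) ≡ suc k →
         (∃ λ t → Q k t × s ≡ c ∷ t) ⊎ (∃ λ t → Q (suc k) t × s ≡ not c ∷ t)
  from {d ∷ s} (|s| , eq) with c ≟ᵇ d
  ... | yes refl = inj₁ (s , (suc-injective |s| , suc-injective eq) , refl)
  ... | no c≢d   = inj₂ (s , (suc-injective |s| , eq) , cong (_∷ s) (¬-not (c≢d ∘ sym)))

-- The run of top letters

-- The letters m + j, …, m + 1.
block : ℕ → ℕ → List ℕ
block zero    m = []
block (suc j) m = suc (j + m) ∷ block j m

length-block : ∀ j m → length (block j m) ≡ j
length-block zero    m = refl
length-block (suc j) m = cong suc (length-block j m)

block-> : ∀ j m → All (m <_) (block j m)
block-> zero    m = []
block-> (suc j) m = s≤s (m≤n+m m j) ∷ block-> j m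

block-≤ : ∀ j m → All (_≤ j + m) (block j m)
block-≤ zero    m = []
block-≤ (suc j) m = ≤-refl ∷ All.map m≤n⇒m≤1+n (block-≤ j m)

block-unique : ∀ j m → Unique (block j m)
block-unique zero    m = []
block-unique (suc j) m = All.map (λ le eq → <⇒≢ (s≤s le) (sym eq)) (block-≤ j m) ∷ block-unique j m

-- The distribution in which the j greatest letters are on side b and the next
-- one, suc (length s), is on the other side.
withRun : Bool → ℕ → List Bool → List Bool
withRun b j s = replicate j b ++ not b ∷ s

length-withRun : ∀ b j s → length (withRun b j s) ≡ j + suc (length s)
length-withRun b zero    s = refl
length-withRun b (suc j) s = cong suc (length-withRun b j s)

letters-withRun : ∀ b j s → lettersOn b (withRun b j s) ≡ block j (suc (length s)) ++ lettersOn b s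
letters-withRun b zero    s = letters-skip b s
letters-withRun b (suc j) s = trans (letters-same b (withRun b j s))
  (cong₂ _∷_ (cong suc (length-withRun b j s)) (letters-withRun b j s))

other-letters-withRun : ∀ b j s →
  lettersOn (not b) (withRun b j s) ≡ suc (length s) ∷ lettersOn (not b) s
other-letters-withRun b zero    s = letters-same (not b) s
other-letters-withRun b (suc j) s = trans (letters-other b (withRun b j s)) (other-letters-withRun b j s)

-- The top letters on side b are those of the run.
top-withRun : ∀ b j s → top (lettersOn b (withRun b j s)) (lettersOn (not b) (withRun b j s)) ≡
              block j (suc (length s))
top-withRun b j s rewrite letters-withRun b j s | other-letters-withRun b j s = begin
  filter P? (block j m ++ lettersOn b s)             ≡⟨ filter-++ P? (block j m) (lettersOn b s) ⟩
  filter P? (block j m) ++ filter P? (lettersOn b s) ≡⟨ cong₂ _++_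
    (filter-all P? (All.map
      (λ m<x → m<x ∷ All.map (λ le → <-trans (s≤s le) m<x) (letters-≤ (not b) s)) (block-> j m)))
    (filter-none P? (All.map (λ x≤ above → <⇒≱ (All.head above) (m≤n⇒m≤1+n x≤)) (letters-≤ b s))) ⟩
  block j m ++ []                                    ≡⟨ ++-identityʳ (block j m) ⟩
  block j m                                          ∎
  where
  open ≡-Reasoning
  m = suc (length s)
  P? = above? (m ∷ lettersOn (not b) s)

other-top-empty : ∀ b s → top (lettersOn (not b) (b ∷ s)) (lettersOn b (b ∷ s)) ≡ []
other-top-empty b s rewrite letters-other b s | letters-same b s =
  filter-none (above? (suc (length s) ∷ lettersOn b s))
    (All.map (λ x≤ above → <⇒≱ (All.head above) (m≤n⇒m≤1+n x≤)) (letters-≤ (not b) s))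

withRun-injective : ∀ b i j {s t} → withRun b i s ≡ withRun b j t → i ≡ j × s ≡ t
withRun-injective b zero    zero    eq = refl , ∷-injectiveʳ eq
withRun-injective b zero    (suc j) eq = contradiction (sym (∷-injectiveˡ eq)) (not-¬ refl)
withRun-injective b (suc i) zero    eq = contradiction (∷-injectiveˡ eq) (not-¬ refl)
withRun-injective b (suc i) (suc j) eq = Product.map₁ (cong suc) (withRun-injective b i j (∷-injectiveʳ eq))

withRun-complete : ∀ b s {k} → length (lettersOn (not b) s) ≡ suc k → ∃ λ j → ∃ λ t → s ≡ withRun b j t
withRun-complete b (d ∷ s) eq with b ≟ᵇ d
... | yes refl = let j , t , s≡ = withRun-complete b s (trans (sym (cong length (letters-other b s))) eq)
                 in suc j , t , cong (b ∷_) s≡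
... | no b≢d   = zero , s , cong (_∷ s) (¬-not (b≢d ∘ sym))

-- A distribution s of n letters with the greatest letter on side b and k letters
-- on the other side, together with an order τ of its top letters.
HalfKey : Bool → ℕ → ℕ → List Bool × List ℕ → Set
HalfKey b n k (s , τ) = (∃ λ t → s ≡ b ∷ t) × length s ≡ n ×
  length (lettersOn (not b) s) ≡ k × τ ↭ top (lettersOn b s) (lettersOn (not b) s)

-- The summation index j is the number of top letters: there are j ! orders of
-- them, letter n ∸ j is on the other side, and the other k letters of that side
-- are chosen among the n ∸ j ∸ 1 letters below.
count-half : ∀ b {n} c k → n ≡ c + suc k →
             Count (HalfKey b n (suc k)) (∑[1⋯ c ] (λ j → (j !) * ((n ∸ j ∸ 1) C k)))
count-half b {n} c k n≡ = count-⇔ to from (count-⋃ {Q = Run} c (λ {i} _ → count-run i) disjoint)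
  where
  Rest : ℕ → List Bool × List ℕ → Set
  Rest i (s , τ) = (length s ≡ n ∸ suc i ∸ 1 × length (lettersOn (not b) s) ≡ k) ×
                   τ ↭ block (suc i) (suc (length s))

  Run : ℕ → List Bool × List ℕ → Set
  Run i key = ∃ λ rest → Rest i rest × key ≡ Product.map₁ (withRun b (suc i)) rest

  count-run : ∀ i → Count (Run i) ((suc i !) * ((n ∸ suc i ∸ 1) C k))
  count-run i = count-map (Product.map₁ (withRun b (suc i)))
    (λ {x} {y} _ _ eq → cong₂ _,_ (proj₂ (withRun-injective b (suc i) (suc i) (cong proj₁ eq))) (cong proj₂ eq))
    (count-cast (*-comm ((n ∸ suc i ∸ 1) C k) (suc i !))
      (count-× (count-sides (not b) (n ∸ suc i ∸ 1) k) λ {s} _ →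
        count-rearrangements (suc i) (length-block (suc i) (suc (length s))) (block-unique (suc i) (suc (length s)))))

  disjoint : ∀ {i j key} → Run i key → Run j key → i ≡ j
  disjoint {i} {j} (_ , _ , eq) (_ , _ , eq′) =
    suc-injective (proj₁ (withRun-injective b (suc i) (suc j) (cong proj₁ (trans (sym eq) eq′))))

  to : ∀ {key} → (∃ λ i → i < c × Run i key) → HalfKey b n (suc k) key
  to (i , i<c , (s , τ) , ((|s| , |other|) , p) , refl) =
    (withRun b i s , refl) ,
    trans (length-withRun b (suc i) s) total ,
    trans (cong length (other-letters-withRun b (suc i) s)) (cong suc |other|) ,
    subst (τ ↭_) (sym (top-withRun b (suc i) s)) p
    where
    i<n : suc i < n
    i<n = ≤-trans (s≤s i<c) (≤-trans (s≤s (m≤m+n c k)) (≤-reflexive (trans (sym (+-suc c k)) (sym n≡))))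

    total : suc i + suc (length s) ≡ n
    total = trans (cong (λ m → suc i + suc m) |s|)
      (trans (cong (suc i +_) (m+[n∸m]≡n {1} (m<n⇒0<n∸m i<n))) (m+[n∸m]≡n (<⇒≤ i<n)))

  from : ∀ {key} → HalfKey b n (suc k) key → ∃ λ i → i < c × Run i key
  from {s , τ} ((t , start) , |s| , |other| , p) with withRun-complete b s |other|
  ... | zero  , s′ , refl = contradiction (sym (∷-injectiveˡ start)) (not-¬ refl)
  ... | suc i , s′ , refl = i , i<c , (s′ , τ) ,
    ((trans (cong (_∸ 1) (sym (m+n∸m≡n (suc i) (suc (length s′))))) (cong (λ m → m ∸ suc i ∸ 1) total) ,
      suc-injective (trans (sym (cong length (other-letters-withRun b (suc i) s′))) |other|)) ,
     subst (τ ↭_) (top-withRun b (suc i) s′) p) , refl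
    where
    total : suc i + suc (length s′) ≡ n
    total = trans (sym (length-withRun b (suc i) s′)) |s|

    same-side : length (lettersOn b (withRun b (suc i) s′)) ≡ c
    same-side = +-cancelʳ-≡ (suc k) _ _ (trans
      (trans (cong (length (lettersOn b (withRun b (suc i) s′)) +_) (sym |other|))
             (letters-length b (withRun b (suc i) s′)))
      (trans |s| n≡))

    i<c : suc i ≤ c
    i<c = ≤-trans (≤-reflexive (sym (length-block (suc i) (suc (length s′)))))
      (≤-trans (length-++-≤ˡ (block (suc i) (suc (length s′))) {lettersOn b s′})
        (≤-reflexive (trans (sym (cong length (letters-withRun b (suc i) s′))) same-side)))

-- Keys and their number

-- The invariants in normal form: a distribution, the top odd letters and the top
-- even letters, each in the order in which they occur.
Key : Set
Key = List Bool × List ℕ × List ℕ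

-- The keys of words with h odd and l even letters.
ValidKey : ℕ → ℕ → Key → Set
ValidKey h l (s , τ₁ , τ₂) =
  (length s ≡ h + l × length (lettersOn true s) ≡ h × length (lettersOn false s) ≡ l) ×
  τ₁ ↭ top (lettersOn true s) (lettersOn false s) ×
  τ₂ ↭ top (lettersOn false s) (lettersOn true s)

count-keys : ∀ h l → let n = suc h + suc l in
  Count (ValidKey (suc h) (suc l))
    (∑[1⋯ suc l ] (λ j → (j !) * ((n ∸ j ∸ 1) C h)) + ∑[1⋯ suc h ] (λ j → (j !) * ((n ∸ j ∸ 1) C l)))
count-keys h l = count-⇔ to from
  (count-⊎ disjoint
    (count-map (λ (s , τ) → s , [] , τ) (λ { _ _ refl → refl })
      (count-half false (suc l) h (+-comm (suc h) (suc l))))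
    (count-map (λ (s , τ) → s , τ , []) (λ { _ _ refl → refl })
      (count-half true (suc h) l refl)))
  where
  n = suc h + suc l

  -- The side of the greatest letter.  The other side has no top letters.
  Even Odd : Key → Set
  Even key = ∃ λ (half : List Bool × List ℕ) →
    HalfKey false n (suc h) half × key ≡ (proj₁ half , [] , proj₂ half)
  Odd key = ∃ λ (half : List Bool × List ℕ) →
    HalfKey true n (suc l) half × key ≡ (proj₁ half , proj₂ half , [])

  disjoint : ∀ {key} → Even key → Odd key → ⊥
  disjoint (_ , ((_ , start) , _) , eq) (_ , ((_ , start′) , _) , eq′)
    with () ← ∷-injectiveˡ (trans (sym start) (trans (cong proj₁ (trans (sym eq) eq′)) start′))

  to : ∀ {key} → Even key ⊎ Odd key → ValidKey (suc h) (suc l) key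
  to (inj₁ ((s , τ) , ((t , refl) , |s| , |odd| , p) , refl)) =
    (|s| , |odd| , +-cancelʳ-≡ (suc h) _ _
      (trans (cong (length (lettersOn false s) +_) (sym |odd|))
        (trans (letters-length false s) (trans |s| (+-comm (suc h) (suc l)))))) ,
    ↭-reflexive (sym (other-top-empty false t)) , p
  to (inj₂ ((s , τ) , ((t , refl) , |s| , |even| , p) , refl)) =
    (|s| , +-cancelʳ-≡ (suc l) _ _
      (trans (cong (length (lettersOn true s) +_) (sym |even|)) (trans (letters-length true s) |s|)) ,
     |even|) ,
    p , ↭-reflexive (sym (other-top-empty true t))

  from : ∀ {key} → ValidKey (suc h) (suc l) key → Even key ⊎ Odd key
  from {[] , _} ((() , _) , _)
  from {false ∷ t , τ₁ , τ₂} ((|s| , |odd| , _) , p₁ , p₂) =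
    inj₁ ((false ∷ t , τ₂) , ((t , refl) , |s| , |odd| , p₂) ,
      cong (λ τ → false ∷ t , τ , τ₂) (↭-empty-inv (↭-trans p₁ (↭-reflexive (other-top-empty false t)))))
  from {true ∷ t , τ₁ , τ₂} ((|s| , _ , |even|) , p₁ , p₂) =
    inj₂ ((true ∷ t , τ₁) , ((t , refl) , |s| , |even| , p₁) ,
      cong (λ τ → true ∷ t , τ₁ , τ) (↭-empty-inv (↭-trans p₂ (↭-reflexive (other-top-empty true t)))))

-- Recovering the parts of a word from its distribution

-- The distribution of the letters 1, …, n with set O of odd letters.
sides : ℕ → List ℕ → List Bool
sides zero    O = []
sides (suc n) O = does (suc n ∈? O) ∷ sides n O

length-sides : ∀ n O → length (sides n O) ≡ n
length-sides zero    O = refl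
length-sides (suc n) O = cong suc (length-sides n O)

sides-cong : ∀ n {O O′} → O ↭ O′ → sides n O ≡ sides n O′
sides-cong zero    p = refl
sides-cong (suc n) {O} {O′} p = cong₂ _∷_
  (does-⇔ (mk⇔ (∈-resp-↭ p) (∈-resp-↭ (↭-sym p))) (suc n ∈? O) (suc n ∈? O′)) (sides-cong n p)

letters-sides⁻ : ∀ n {O k} → k ∈ lettersOn true (sides n O) → k ∈ O
letters-sides⁻ (suc n) {O} k∈ with suc n ∈? O
letters-sides⁻ (suc n) {O} (here refl) | yes n∈ = subst (λ m → suc m ∈ O) (sym (length-sides n O)) n∈
letters-sides⁻ (suc n) {O} (there k∈)  | yes _  = letters-sides⁻ n k∈
letters-sides⁻ (suc n) {O} k∈          | no _   = letters-sides⁻ n k∈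

letters-sides⁺ : ∀ n {O k} → k ∈ O → k ∈ applyUpTo suc n → k ∈ lettersOn true (sides n O)
letters-sides⁺ (suc n) {O} {k} k∈ k∈n
  with suc n ∈? O | ∈-++⁻ (applyUpTo suc n) (subst (k ∈_) (sym (applyUpTo-∷ʳ suc n)) k∈n)
... | yes _  | inj₁ k∈n′        = there (letters-sides⁺ n k∈ k∈n′)
... | yes _  | inj₂ (here refl) = here (cong suc (sym (length-sides n O)))
... | no _   | inj₁ k∈n′        = letters-sides⁺ n k∈ k∈n′
... | no n∉  | inj₂ (here refl) = contradiction k∈ n∉

unique-++⁻ˡ : ∀ {A : Set} (xs : List A) {ys} → Unique (xs ++ ys) → Unique xs
unique-++⁻ˡ []       _        = []
unique-++⁻ˡ (x ∷ xs) (x∉ ∷ u) = All.++⁻ˡ xs x∉ ∷ unique-++⁻ˡ xs u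

unique-++⇒disjoint : ∀ {A : Set} (xs : List A) {ys} → Unique (xs ++ ys) → Disjoint xs ys
unique-++⇒disjoint (x ∷ xs) (x∉ ∷ u) (here refl , y∈) = All.lookup (All.++⁻ʳ xs x∉) y∈ refl
unique-++⇒disjoint (x ∷ xs) (x∉ ∷ u) (there x∈ , y∈)  = unique-++⇒disjoint xs u (x∈ , y∈)

letters-unique : ∀ c s → Unique (lettersOn c s)
letters-unique c s = unique-++⁻ˡ (lettersOn c s)
  (unique-resp-↭ (↭-sym (letters-↭ c s)) (applyUpTo-suc-unique (length s)))

letters-sides-odd : ∀ n {as bs} → as ++ bs ↭ applyUpTo suc n → lettersOn true (sides n as) ↭ as
letters-sides-odd n {as} p = ∼bag⇒↭ (unique∧set⇒bag
  (letters-unique true (sides n as))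
  (unique-++⁻ˡ as (unique-resp-↭ (↭-sym p) (applyUpTo-suc-unique n)))
  (mk⇔ (letters-sides⁻ n) (λ k∈ → letters-sides⁺ n k∈ (∈-resp-↭ p (∈-++⁺ˡ k∈)))))

letters-sides-even : ∀ n {as bs} → as ++ bs ↭ applyUpTo suc n → lettersOn false (sides n as) ↭ bs
letters-sides-even n {as} {bs} p = drop-++ˡ as (↭-trans
  (++⁺ʳ (lettersOn false s) (↭-sym (letters-sides-odd n p)))
  (↭-trans (letters-↭ true s)
    (↭-trans (↭-reflexive (cong (applyUpTo suc) (length-sides n as))) (↭-sym p))))
  where s = sides n as

sides-letters : ∀ s {O} → (∀ {k} → k ≤ length s → k ∈ O → k ∈ lettersOn true s) →
                (∀ {k} → k ≤ length s → k ∈ lettersOn true s → k ∈ O) →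
                sides (length s) O ≡ s
sides-letters []          _  _    = refl
sides-letters (true ∷ s)  {O} to from = cong₂ _∷_
  (dec-true (suc (length s) ∈? O) (from ≤-refl (here refl)))
  (sides-letters s
    (λ k≤ k∈ → Any.tail (<⇒≢ (s≤s k≤)) (to (m≤n⇒m≤1+n k≤) k∈))
    (λ k≤ k∈ → from (m≤n⇒m≤1+n k≤) (there k∈)))
sides-letters (false ∷ s) {O} to from = cong₂ _∷_
  (dec-false (suc (length s) ∈? O) (λ n∈ → <⇒≱ (n<1+n (length s)) (All.lookup (letters-≤ true s) (to ≤-refl n∈))))
  (sides-letters s (to ∘ m≤n⇒m≤1+n) (from ∘ m≤n⇒m≤1+n))

length-odds  : ∀ w → length (odds w) ≡ ⌈ length w /2⌉
length-evens : ∀ w → length (evens w) ≡ ⌊ length w /2⌋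
length-odds  []      = refl
length-odds  (x ∷ w) = cong suc (length-evens w)
length-evens []      = refl
length-evens (x ∷ w) = length-odds w

top-resp-↭ : ∀ {as bs as′ bs′} → as ↭ as′ → bs ↭ bs′ → top as bs ↭ top as′ bs′
top-resp-↭ {as} {bs} {as′} {bs′} p q =
  ↭-trans (↭-reflexive (top-congʳ as q)) (filter-↭ (above? bs′) p)

-- Every order of the entries of xs in P is the order in some rearrangement of xs.
realise-filter : ∀ {A : Set} {P : Pred A 0ℓ} (P? : Decidable P) {τ} xs → τ ↭ filter P? xs →
                 ∃ λ ys → ys ↭ xs × filter P? ys ≡ τ
realise-filter {P} P? {τ} xs p = τ ++ filter (¬? ∘ P?) xs ,
  ↭-trans (++⁺ʳ _ p) (filters-↭ xs) ,
  trans (filter-++ P? τ _) (trans (cong₂ _++_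
    (filter-all P? (All.tabulate λ x∈ → All.lookup (All.all-filter P? xs) (∈-resp-↭ p x∈)))
    (filter-none P? (All.all-filter (¬? ∘ P?) xs)))
    (++-identityʳ τ))
  where
  filters-↭ : ∀ xs → filter P? xs ++ filter (¬? ∘ P?) xs ↭ xs
  filters-↭ []       = ↭-refl
  filters-↭ (x ∷ xs) with does (P? x)
  ... | true  = prep x (filters-↭ xs)
  ... | false = ↭-trans (shift x (filter P? xs) _) (prep x (filters-↭ xs))

weave-↭ : ∀ as bs → Balanced as bs → weave as bs ↭ as ++ bs
weave-↭ as bs bal = ↭-trans (↭-sym (odds++evens-↭ (weave as bs)))
  (↭-reflexive (cong₂ _++_ (odds-weave as bs bal) (evens-weave as bs bal)))

halves : ∀ n → ⌈ n /2⌉ + ⌊ n /2⌋ ≡ n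
halves n = trans (+-comm ⌈ n /2⌉ ⌊ n /2⌋) (⌊n/2⌋+⌈n/2⌉≡n n)

⌈/2⌉-cases : ∀ n → ⌈ n /2⌉ ≡ ⌊ n /2⌋ ⊎ ⌈ n /2⌉ ≡ suc ⌊ n /2⌋
⌈/2⌉-cases zero          = inj₁ refl
⌈/2⌉-cases (suc zero)    = inj₂ refl
⌈/2⌉-cases (suc (suc n)) = Sum.map (cong suc) (cong suc) (⌈/2⌉-cases n)

-- The key of a permutation

~⇒similar : ∀ {v w} → v ~ w → Similar (odds v) (evens v) (odds w) (evens w)
~⇒similar = Eq.gfold similar-isEquivalence (λ w → odds w , evens w) step-similar
  where

  similar-isEquivalence : IsEquivalence λ (x y : List ℕ × List ℕ) →
    Similar (proj₁ x) (proj₂ x) (proj₁ y) (proj₂ y)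
  similar-isEquivalence = record
    { refl  = record { odd-↭ = ↭-refl ; even-↭ = ↭-refl ; odd-top = refl ; even-top = refl }
    ; sym   = λ s → record
      { odd-↭ = ↭-sym (odd-↭ s) ; even-↭ = ↭-sym (even-↭ s)
      ; odd-top = sym (odd-top s) ; even-top = sym (even-top s) }
    ; trans = λ s t → record
      { odd-↭ = ↭-trans (odd-↭ s) (odd-↭ t) ; even-↭ = ↭-trans (even-↭ s) (even-↭ t)
      ; odd-top = trans (odd-top s) (odd-top t) ; even-top = trans (even-top s) (even-top t) }
    }
    where open Similar

module _ {n : ℕ} where

  -- The word of a permutation, as a list.
  letters : Perm n → List ℕ
  letters φ = toList (word φ)

  -- The complete invariant of the classes.
  key : Perm n → Key
  key φ = sides n (odds w) , top (odds w) (evens w) , top (evens w) (odds w)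
    where w = letters φ

  odds++evens-letters : ∀ φ → odds (letters φ) ++ evens (letters φ) ↭ applyUpTo suc n
  odds++evens-letters φ = ↭-trans (odds++evens-↭ (letters φ)) (word-↭ φ)

  length-letters : ∀ φ → length (letters φ) ≡ n
  length-letters φ = trans (↭-length (word-↭ φ)) (length-applyUpTo suc n)

  key-valid : ∀ φ → ValidKey ⌈ n /2⌉ ⌊ n /2⌋ (key φ)
  key-valid φ =
    (trans (length-sides n (odds w)) (sym (halves n)) ,
     trans (↭-length odd) (trans (length-odds w) (cong ⌈_/2⌉ (length-letters φ))) ,
     trans (↭-length even) (trans (length-evens w) (cong ⌊_/2⌋ (length-letters φ)))) ,
    top-resp-↭ (↭-sym odd) (↭-sym even) , top-resp-↭ (↭-sym even) (↭-sym odd)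
    where
    w = letters φ
    odd = letters-sides-odd n (odds++evens-letters φ)
    even = letters-sides-even n (odds++evens-letters φ)

  open Setoid (S[ n ]/ K₀) using (_≈_)

  key-cong : ∀ {φ ψ} → φ ≈ ψ → key φ ≡ key ψ
  key-cong {φ} {ψ} φ≈ψ = cong₂ _,_ (sides-cong n (odd-↭ sim)) (cong₂ _,_ (odd-top sim) (even-top sim))
    where
    open Similar
    sim = ~⇒similar (≈⇒~ φ≈ψ)

  key-injective : ∀ {φ ψ} → key φ ≡ key ψ → φ ≈ ψ
  key-injective {φ} {ψ} eq = ~⇒≈ {φ = φ} {ψ} (similar⇒~
    (unique-++⇒disjoint (odds (letters φ))
      (unique-resp-↭ (↭-sym (odds++evens-letters φ)) (applyUpTo-suc-unique n)))
    record
      { odd-↭    = through true (λ as _ → as) (letters-sides-odd n)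
      ; even-↭   = through false (λ _ bs → bs) (letters-sides-even n)
      ; odd-top  = cong (proj₁ ∘ proj₂) eq
      ; even-top = cong (proj₂ ∘ proj₂) eq
      })
    where
    through : ∀ c (part : List ℕ → List ℕ → List ℕ) →
              (∀ {as bs} → as ++ bs ↭ applyUpTo suc n → lettersOn c (sides n as) ↭ part as bs) →
              part (odds (letters φ)) (evens (letters φ)) ↭ part (odds (letters ψ)) (evens (letters ψ))
    through c part f = ↭-trans (↭-sym (f (odds++evens-letters φ)))
      (↭-trans (↭-reflexive (cong (lettersOn c ∘ proj₁) eq)) (f (odds++evens-letters ψ)))

  -- A word with the given key has its top letters first among the letters of their
  -- parity, in the prescribed order.
  key-surjective : ∀ {k} → ValidKey ⌈ n /2⌉ ⌊ n /2⌋ k → ∃ λ φ → key φ ≡ k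
  key-surjective {s , τ₁ , τ₂} ((|s| , |odd| , |even|) , p₁ , p₂)
    with as , as↭ , as-top ← realise-filter (above? (lettersOn false s)) (lettersOn true s) p₁
       | bs , bs↭ , bs-top ← realise-filter (above? (lettersOn true s)) (lettersOn false s) p₂
    = φ , key-φ
    where
    |s|≡n : length s ≡ n
    |s|≡n = trans |s| (halves n)

    balanced : Balanced as bs
    balanced = balanced-resp-↭ (↭-sym as↭) (↭-sym bs↭)
      (Sum.map (λ eq → trans |odd| (trans eq (sym |even|)))
               (λ eq → trans |odd| (trans eq (cong suc (sym |even|)))) (⌈/2⌉-cases n))

    realised : ∃ λ (φ : Perm n) → letters φ ≡ weave as bs
    realised = from-word (weave as bs)
      (↭-trans (weave-↭ as bs balanced) (↭-trans (++⁺ as↭ bs↭)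
        (↭-trans (letters-↭ true s) (↭-reflexive (cong (applyUpTo suc) |s|≡n)))))

    φ = proj₁ realised

    odds-φ : odds (letters φ) ≡ as
    odds-φ = trans (cong odds (proj₂ realised)) (odds-weave as bs balanced)

    evens-φ : evens (letters φ) ≡ bs
    evens-φ = trans (cong evens (proj₂ realised)) (evens-weave as bs balanced)

    sides-as : sides n as ≡ s
    sides-as = trans (cong (λ m → sides m as) (sym |s|≡n))
      (sides-letters s (λ _ → ∈-resp-↭ as↭) (λ _ → ∈-resp-↭ (↭-sym as↭)))

    key-φ : key φ ≡ (s , τ₁ , τ₂)
    key-φ = trans (cong₂ (λ as bs → sides n as , top as bs , top bs as) odds-φ evens-φ)
      (cong₂ _,_ sides-as (cong₂ _,_
        (trans (top-congʳ as bs↭) as-top) (trans (top-congʳ bs as↭) bs-top)))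

corollary3p49 : (n : ℕ) → 3 ≤ n →
    let l = ⌊ n /2⌋
        h = ⌈ n /2⌉
    in Bijection (S[ n ]/ K₀)
         (setoid (Fin (∑[1⋯ l ] (λ j → (j !) * ((n ∸ j ∸ 1) C (h ∸ 1)))
                     + ∑[1⋯ h ] (λ j → (j !) * ((n ∸ j ∸ 1) C (l ∸ 1))))))
-- With n = m + 2, the numbers h ∸ 1 and l ∸ 1 are ⌈ m /2⌉ and ⌊ m /2⌋.
corollary3p49 n@(suc (suc m)) (s≤s _) = count-bijection (S[ n ]/ K₀)
  (subst (λ k → Count (ValidKey ⌈ n /2⌉ ⌊ n /2⌋)
           (∑[1⋯ ⌊ n /2⌋ ] (λ j → (j !) * ((k ∸ j ∸ 1) C ⌈ m /2⌉)) +
            ∑[1⋯ ⌈ n /2⌉ ] (λ j → (j !) * ((k ∸ j ∸ 1) C ⌊ m /2⌋))))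
    (halves n)
    (count-keys ⌈ m /2⌉ ⌊ m /2⌋))
  key key-valid (λ {φ} {ψ} → key-cong {φ = φ} {ψ}) (λ {φ} {ψ} → key-injective {φ = φ} {ψ}) key-surjective
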